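{- Let $q$ be a prime power, let $1\le t\le k\le v$ be integers and let $\lambda\ge 0$ be a rational number. Suppose that the derived and the residual parameter set of the parameter set $t$-$(v,k,\lambda)_q$ are realizable, i.e. that there exist a $(t-1)$-$(v-1,k-1,\lambda)_q$ design and a $(t-1)$-$\left(v-1,k,\lambda\cdot\frac{q^{v-k}-1}{q^{k-t+1}-1}\right)_q$ design. Then the reduced parameter set is realizable, too, i.e. there exists a $(t-1)$-$\left(v,k,\lambda\cdot\frac{q^{v-t+1}-1}{q^{k-t+1}-1}\right)_q$ design. (It is not assumed that a $t$-$(v,k,\lambda)_q$ design exists.)
   Context: For a finite-dimensional vector space $V$ over the finite field $\mathrm{GF}(q)$, a $k$-subspace is a linear subspace of dimension $k$. For a $v$-dimensional vector space $V$ over $\mathrm{GF}(q)$, a pair $(V,\mathcal{B})$ with $\mathcal{B}$ a set of $k$-subspaces of $V$ (called blocks) is a $t$-$(v,k,\lambda)_q$ (subspace) design if every $t$-subspace of $V$ is contained in exactly $\lambda$ elements of $\mathcal{B}$. A parameter set $t$-$(v,k,\lambda)_q$ is realizable if a $t$-$(v,k,\lambda)_q$ design exists. For a parameter set $t$-$(v,k,\lambda)_q$: the reduced parameter set is $(t-1)$-$(v,k,\lambda_{t-1})_q$ with $\lambda_{t-1}=\lambda\cdot\frac{q^{v-t+1}-1}{q^{k-t+1}-1}$; the derived parameter set is $(t-1)$-$(v-1,k-1,\lambda)_q$; the residual parameter set is $(t-1)$-$\left(v-1,k,\lambda\cdot\frac{q^{v-k}-1}{q^{k-t+1}-1}\right)_q$.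 -}

module Defs where

open import Algebra.Bundles using (CommutativeRing)
open import Algebra.Module.Bundles using (Module)
import Algebra.Definitions.RawMonoid as RawMonoidOps
open import Data.Fin.Base using (Fin)
open import Data.Fin.Subset as Subset using (Subset; ∣_∣)
import Data.Integer.Base as ℤ
open import Data.Nat.Base as ℕ using (ℕ; suc; _∸_; _^_; _≥_; NonZero; NonTrivial)
import Data.Nat.Properties as ℕ
open import Data.Nat.Primality using (Prime; prime⇒nonTrivial)
open import Data.Product.Base using (Σ-syntax; ∃-syntax; _×_)
open import Data.Rational.Base as ℚ using (ℚ)
open import Data.Vec.Functional using (Vector)
open import Function.Bundles using (Inverse; _⇔_)
open import Function.Definitions using (Injective)
open import Level using (_⊔_) renaming (suc to lsuc)
open import Relation.Binary.PropositionalEquality.Core using (_≡_; refl)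
import Relation.Binary.PropositionalEquality.Properties as ≡
open import Relation.Nullary.Negation.Core using (¬_)
open import Relation.Unary using (Pred; _∈_; _⊆_; _≐_; U)

record PrimePower (q : ℕ) : Set where
  field
    p        : ℕ
    n        : ℕ
    p-prime  : Prime p
    n≥1      : n ≥ 1
    q≡p^n    : q ≡ p ^ n

-- GF(q) is unique up to isomorphism, so "over GF(q)" is read as
-- "over F", for an arbitrary field F with exactly q elements.
record GF (q : ℕ) c ℓ : Set (lsuc (c ⊔ ℓ)) where
  field
    commutativeRing : CommutativeRing c ℓ

  open CommutativeRing commutativeRing public

  field
    0≉1         : ¬ (0# ≈ 1#)
    invertible  : ∀ x → ¬ (x ≈ 0#) → ∃[ y ] x * y ≈ 1#
    enumeration : Inverse setoid (≡.setoid (Fin q))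

module _ {q c ℓ} (F : GF q c ℓ) where

  VectorSpace : Set (lsuc (c ⊔ ℓ))
  VectorSpace = Module (GF.commutativeRing F) c ℓ

  module _ (V : VectorSpace) where
    open GF F using (Carrier; _≈_; 0#)
    open Module V using (Carrierᴹ; _≈ᴹ_; _+ᴹ_; _*ₗ_; 0ᴹ; +ᴹ-rawMonoid)
    open RawMonoidOps +ᴹ-rawMonoid using (sum)

    -- The level c ⊔ ℓ is the one at which spans of vectors live.
    record Subspace : Set (lsuc (c ⊔ ℓ)) where
      field
        ⟦_⟧       : Pred Carrierᴹ (c ⊔ ℓ)
        resp      : ∀ {x y} → x ≈ᴹ y → x ∈ ⟦_⟧ → y ∈ ⟦_⟧
        0ᴹ∈       : 0ᴹ ∈ ⟦_⟧
        +ᴹ-closed : ∀ {x y} → x ∈ ⟦_⟧ → y ∈ ⟦_⟧ → (x +ᴹ y) ∈ ⟦_⟧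
        *ₗ-closed : ∀ a {x} → x ∈ ⟦_⟧ → (a *ₗ x) ∈ ⟦_⟧

    linearCombination : ∀ {n} → Vector Carrier n → Vector Carrierᴹ n → Carrierᴹ
    linearCombination a b = sum (λ i → a i *ₗ b i)

    record IsBasis {p n} (W : Pred Carrierᴹ p) (b : Vector Carrierᴹ n)
                   : Set (c ⊔ ℓ ⊔ p) where
      field
        contained   : ∀ i → b i ∈ W
        independent : ∀ a → linearCombination a b ≈ᴹ 0ᴹ → ∀ i → a i ≈ 0#
        spanning    : ∀ {x} → x ∈ W → ∃[ a ] x ≈ᴹ linearCombination a b

    HasDimension : ∀ {p} → Pred Carrierᴹ p → ℕ → Set (c ⊔ ℓ ⊔ p)
    HasDimension W n = Σ[ b ∈ Vector Carrierᴹ n ] IsBasis W b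

open Subspace public using (⟦_⟧)

record Parameters (q : ℕ) : Set where
  constructor _-⟨_,_,_⟩
  field
    t v k  : ℕ
    lambda : ℚ

primePower⇒nonTrivial : ∀ {q} → PrimePower q → NonTrivial q
primePower⇒nonTrivial
  record { p = p ; n = suc n ; p-prime = pr ; q≡p^n = refl } =
  ℕ.n≢0∧m>1⇒m*n>1 p (p ^ n)
  where instance
    _ = prime⇒nonTrivial pr
    _ = ℕ.nonTrivial⇒nonZero p
    _ = ℕ.m^n≢0 p n

q^[1+n]∸1≢0 : ∀ q n → {{PrimePower q}} → NonZero (q ^ suc n ∸ 1)
q^[1+n]∸1≢0 q n {{pp}} =
  ℕ.>-nonZero (ℕ.m<n⇒0<n∸m (ℕ.nonTrivial⇒n>1 (q ^ suc n)))
  where instance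
    _ = primePower⇒nonTrivial pp
    _ = ℕ.nonTrivial⇒nonZero q
    _ = ℕ.m^n≢0 q n
    _ = ℕ.n≢0∧m>1⇒m*n>1 q (q ^ n)

module _ {q : ℕ} where

  -- The subtractions below are exact whenever 1 ≤ t ≤ k ≤ v.

  derived : Parameters q → Parameters q
  derived (t -⟨ v , k , lambda ⟩) = (t ∸ 1) -⟨ v ∸ 1 , k ∸ 1 , lambda ⟩

  module _ {{_ : PrimePower q}} where

    reduced : Parameters q → Parameters q
    reduced (t -⟨ v , k , lambda ⟩) =
      (t ∸ 1) -⟨ v , k , lambda ℚ.* (ℤ.+ (q ^ suc (v ∸ t) ∸ 1) ℚ./ (q ^ suc (k ∸ t) ∸ 1)) ⟩
      where instance _ = q^[1+n]∸1≢0 q (k ∸ t)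

    residual : Parameters q → Parameters q
    residual (t -⟨ v , k , lambda ⟩) =
      (t ∸ 1) -⟨ v ∸ 1 , k , lambda ℚ.* (ℤ.+ (q ^ (v ∸ k) ∸ 1) ℚ./ (q ^ suc (k ∸ t) ∸ 1)) ⟩
      where instance _ = q^[1+n]∸1≢0 q (k ∸ t)

module _ {q c ℓ} (F : GF q c ℓ) where

  -- The set of blocks is finite because V is; it is given by a listing
  -- without repetition, where two subspaces are equal when they have the
  -- same vectors.
  record SubspaceDesign (V : VectorSpace F) (P : Parameters q)
                        : Set (lsuc (c ⊔ ℓ)) where
    open Parameters P
    field
      dim-V          : HasDimension F V U v
      size           : ℕ
      block          : Fin size → Subspace F V
      block-distinct : Injective _≡_ (λ B C → ⟦ B ⟧ ≐ ⟦ C ⟧) block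
      block-dim      : ∀ i → HasDimension F V ⟦ block i ⟧ k
      balanced       : ∀ (T : Subspace F V) → HasDimension F V ⟦ T ⟧ t →
                       Σ[ S ∈ Subset size ]
                         (∀ i → (i Subset.∈ S) ⇔ (⟦ T ⟧ ⊆ ⟦ block i ⟧))
                         × (ℤ.+ ∣ S ∣ ℚ./ 1 ≡ lambda)

  Realizable : Parameters q → Set (lsuc (c ⊔ ℓ))
  Realizable P = Σ[ V ∈ VectorSpace F ] SubspaceDesign V P

{-# OPTIONS --safe #-}

-- Write t = s + 1 and let D be a derived and R a residual design, both
-- moved to the same space V; they are combined into a design on F × V with
-- hyperplane H = {0} × V. Its blocks are the blocks of R, placed in H, and
-- for each block D_i the q^(v-k) subspaces of dimension k that meet H in
-- D_i. Let T be an s-subspace. If T lies in H, it is contained in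
-- λ q^(v-k) + λ (q^(v-k) - 1) / (q^(k-t+1) - 1) blocks. Otherwise T ∩ H has
-- dimension s - 1 and every D_i containing it has exactly one extension
-- that contains T, so the number of blocks through T is the number of
-- blocks of D through an (s-1)-subspace. Both numbers are
-- λ (q^(v-t+1) - 1) / (q^(k-t+1) - 1).

module Submission where

open import Defs
open import Data.Nat.Base using (ℕ; _≤_)
open import Data.Rational.Base using (ℚ; 0ℚ) renaming (_≤_ to _≤ℚ_)
open import Level using (Level)

open import Algebra.Bundles using (CommutativeMonoid)
open import Algebra.Module.Bundles using (Module)
import Algebra.Module.Construct.DirectProduct as DirectProduct
import Algebra.Module.Construct.TensorUnit as TensorUnit
import Algebra.Properties.CommutativeSemigroup as CommutativeSemigroupProperties
import Algebra.Properties.Ring as RingProperties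
open import Data.Bool.Base using (true; if_then_else_)
open import Data.Fin.Base as Fin using (Fin; zero; suc)
import Data.Fin.Properties as Fin
open import Data.Fin.Subset as Subset using (Subset; ∣_∣; inside; outside)
import Data.Fin.Subset.Properties as Subset
import Data.Integer.Base as ℤ
import Data.Integer.Properties as ℤ
open import Data.Nat.Base as ℕ using (zero; suc)
import Data.Nat.Properties as ℕ
open import Data.Nat.Tactic.RingSolver using (solve-∀)
open import Data.Product.Base using (_×_; _,_; proj₁; proj₂; ∃-syntax; Σ-syntax; map₁)
import Data.Rational.Base as ℚ
import Data.Rational.Properties as ℚ
import Data.Rational.Unnormalised.Base as ℚᵘ
import Data.Rational.Unnormalised.Properties as ℚᵘ
open import Data.Sum.Base as Sum using (_⊎_; inj₁; inj₂)
open import Data.Unit.Polymorphic.Base using (⊤; tt)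
import Data.Vec.Base as Vec
open import Data.Vec.Functional using (Vector; []; _∷_)
import Data.Vec.Properties as Vec
open import Function.Base using (_∘_)
open import Function.Bundles using (_⇔_; mk⇔; Equivalence; Inverse)
open import Function.Construct.Composition using (_⇔-∘_)
open import Function.Definitions using (Injective)
open import Level using (_⊔_; Lift; lift)
open import Relation.Binary.PropositionalEquality as ≡ using (_≡_)
import Relation.Binary.Reasoning.Setoid as SetoidReasoning
open import Relation.Nullary.Decidable using (Dec; yes; no; does; dec-true; dec-false; does-⇔; map′)
open import Relation.Nullary.Negation.Core using (¬_; contradiction)
open import Relation.Unary using (Pred; Decidable; _∈_; _⊆_; _≐_; U)

open import Algebra.Properties.Semiring.Sum ℕ.+-*-semiring
  using (sum-syntax; sum-cong-≗; ∑-comm; ∑-distrib-+; *-distribˡ-sum; *-distribʳ-sum)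

-- The k-subspaces meeting H in D_i are the spans of D_i and (1, h) with h in V, and two of them
-- agree exactly when the two values of h agree modulo D_i. Hence q^(v-k): it is the number of
-- cosets of D_i, of dimension k-1, in V, of dimension v-1. A subspace T outside H contains some (1,
-- h), and the coset of h singles out the extension containing T. The two block numbers agree
-- because q^r (q^u - 1) + (q^r - 1) = q^(r+u) - 1 for r = v-k and u = k-t+1. The number N of blocks
-- of D through an (s-1)-subspace comes from counting pairs of a block and a vector, without
-- Gaussian coefficients: N (q^(k-1) - q^(s-1)) = λ (q^(v-1) - q^(s-1)). Subspaces are bare
-- predicates, so containment has to be decided before anything is counted; bases and the finite
-- enumeration of V provide this. The rational λ is replaced by the number of blocks of D through an
-- actual s-subspace, which leaves an identity of natural numbers.

private variable
  p : Level
  m n : ℕ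

-- Counting over Fin

𝟙 : {P : Set p} → Dec P → ℕ
𝟙 P? = if does P? then 1 else 0

𝟙-yes : {P : Set p} (P? : Dec P) → P → 𝟙 P? ≡ 1
𝟙-yes P? p = ≡.cong (if_then 1 else 0) (dec-true P? p)

𝟙-no : {P : Set p} (P? : Dec P) → ¬ P → 𝟙 P? ≡ 0
𝟙-no P? ¬p = ≡.cong (if_then 1 else 0) (dec-false P? ¬p)

𝟙-cong : ∀ {p₁ p₂} {P : Set p₁} {Q : Set p₂} (P? : Dec P) (Q? : Dec Q) → P ⇔ Q → 𝟙 P? ≡ 𝟙 Q?
𝟙-cong P? Q? P⇔Q = ≡.cong (if_then 1 else 0) (does-⇔ P⇔Q P? Q?)

count : {P : Pred (Fin n) p} → Decidable P → ℕ
count P? = ∑[ i < _ ] 𝟙 (P? i)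

count-cong : ∀ {p₁ p₂} {P : Pred (Fin n) p₁} {Q : Pred (Fin n) p₂}
             (P? : Decidable P) (Q? : Decidable Q) → (∀ i → P i ⇔ Q i) → count P? ≡ count Q?
count-cong P? Q? P⇔Q = sum-cong-≗ λ i → 𝟙-cong (P? i) (Q? i) (P⇔Q i)

∑-const : ∀ m n → ∑[ i < m ] n ≡ m ℕ.* n
∑-const zero    n = ≡.refl
∑-const (suc m) n = ≡.cong (n ℕ.+_) (∑-const m n)

count-none : {P : Pred (Fin n) p} (P? : Decidable P) → (∀ i → ¬ P i) → count P? ≡ 0
count-none {n = n} P? ¬P =
  ≡.trans (sum-cong-≗ λ i → 𝟙-no (P? i) (¬P i)) (≡.trans (∑-const n 0) (ℕ.*-zeroʳ n))

count-unique : {P : Pred (Fin n) p} (P? : Decidable P) →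
               ∀ i → P i → (∀ j → P j → i ≡ j) → count P? ≡ 1
count-unique P? zero    pi unique =
  ≡.cong₂ ℕ._+_ (𝟙-yes (P? zero) pi)
                (count-none (P? ∘ suc) λ j pj → contradiction (unique (suc j) pj) λ ())
count-unique P? (suc i) pi unique =
  ≡.cong₂ ℕ._+_ (𝟙-no (P? zero) λ p0 → contradiction (unique zero p0) λ ())
                (count-unique (P? ∘ suc) i pi λ j pj → Fin.suc-injective (unique (suc j) pj))

-- Sum the indicator of `f j ≡ i` over both indices. For fixed `i` it gives the indicator of `P i`,
-- because `f` hits exactly the indices satisfying `P`, each once; for fixed `j` it gives 1.
count-image : {P : Pred (Fin n) p} (P? : Decidable P) (f : Fin m → Fin n) → Injective _≡_ _≡_ f →
              (∀ j → P (f j)) → (∀ i → P i → ∃[ j ] f j ≡ i) → count P? ≡ m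
count-image {n = n} {m = m} P? f inj into onto = begin
  count P?                                    ≡⟨ sum-cong-≗ fibre ⟩
  (∑[ i < n ] ∑[ j < m ] 𝟙 (f j Fin.≟ i))     ≡⟨ ∑-comm (λ i j → 𝟙 (f j Fin.≟ i)) ⟩
  (∑[ j < m ] ∑[ i < n ] 𝟙 (f j Fin.≟ i))     ≡⟨ sum-cong-≗ (λ j → count-unique (f j Fin.≟_) (f j) ≡.refl λ _ e → e) ⟩
  ∑[ j < m ] 1                                ≡⟨ ≡.trans (∑-const m 1) (ℕ.*-identityʳ m) ⟩
  m                                           ∎
  where
  open ≡.≡-Reasoning
  fibre : ∀ i → 𝟙 (P? i) ≡ ∑[ j < m ] 𝟙 (f j Fin.≟ i)
  fibre i with P? i
  ... | yes pi = let (j , fj≡i) = onto i pi in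
                 ≡.sym (count-unique (λ j → f j Fin.≟ i) j fj≡i λ j′ e → inj (≡.trans fj≡i (≡.sym e)))
  ... | no ¬pi = ≡.sym (count-none (λ j → f j Fin.≟ i) λ j e → ¬pi (≡.subst _ e (into j)))

∑-splitAt : ∀ m {n} (f : Fin m ⊎ Fin n → ℕ) →
            ∑[ i < m ℕ.+ n ] f (Fin.splitAt m i) ≡ ∑[ i < m ] f (inj₁ i) ℕ.+ ∑[ j < n ] f (inj₂ j)
∑-splitAt zero    f = ≡.refl
∑-splitAt (suc m) f =
  ≡.trans (≡.cong (f (inj₁ zero) ℕ.+_) (∑-splitAt m (f ∘ Sum.map₁ suc))) (≡.sym (ℕ.+-assoc (f (inj₁ zero)) _ _))

∑-remQuot : ∀ m {n} (f : Fin m × Fin n → ℕ) →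
            ∑[ k < m ℕ.* n ] f (Fin.remQuot n k) ≡ ∑[ i < m ] ∑[ j < n ] f (i , j)
∑-remQuot zero        f = ≡.refl
∑-remQuot (suc m) {n} f = begin
  ∑[ k < n ℕ.+ m ℕ.* n ] f (Fin.remQuot n k)      ≡⟨ sum-cong-≗ {n ℕ.+ m ℕ.* n} unfold ⟩
  ∑[ k < n ℕ.+ m ℕ.* n ] g (Fin.splitAt n k)      ≡⟨ ∑-splitAt n g ⟩
  ∑[ j < n ] f (zero , j) ℕ.+ ∑[ k < m ℕ.* n ] f (map₁ suc (Fin.remQuot n k))
    ≡⟨ ≡.cong ((∑[ j < n ] f (zero , j)) ℕ.+_) (∑-remQuot m (f ∘ map₁ suc)) ⟩
  ∑[ j < n ] f (zero , j) ℕ.+ ∑[ i < m ] ∑[ j < n ] f (suc i , j) ∎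
  where
  open ≡.≡-Reasoning
  g : Fin n ⊎ Fin (m ℕ.* n) → ℕ
  g (inj₁ j) = f (zero , j)
  g (inj₂ k) = f (map₁ suc (Fin.remQuot n k))
  unfold : ∀ k → f (Fin.remQuot n k) ≡ g (Fin.splitAt n k)
  unfold k with Fin.splitAt n k
  ... | inj₁ j = ≡.refl
  ... | inj₂ k = ≡.refl

∣∣≡count : (S : Subset n) {P : Pred (Fin n) p} (P? : Decidable P) →
          (∀ i → (i Subset.∈ S) ⇔ P i) → ∣ S ∣ ≡ count P?
∣∣≡count Vec.[]        P? S⇔P = ≡.refl
∣∣≡count (b Vec.∷ S) P? S⇔P with ∣∣≡count S (P? ∘ suc) (λ i →
  mk⇔ (Equivalence.to (S⇔P (suc i)) ∘ Vec.there) (Subset.drop-there ∘ Equivalence.from (S⇔P (suc i))))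
∣∣≡count (inside  Vec.∷ S) P? S⇔P | rest =
  ≡.cong₂ ℕ._+_ (≡.sym (𝟙-yes (P? zero) (Equivalence.to (S⇔P zero) Vec.here))) rest
∣∣≡count (outside Vec.∷ S) P? S⇔P | rest =
  ≡.cong₂ ℕ._+_ (≡.sym (𝟙-no (P? zero) λ p0 → contradiction (Equivalence.from (S⇔P zero) p0) λ ())) rest

select : {P : Pred (Fin n) p} → Decidable P → Subset n
select P? = Vec.tabulate (does ∘ P?)

∈-select : {P : Pred (Fin n) p} (P? : Decidable P) → ∀ i → (i Subset.∈ select P?) ⇔ P i
∈-select P? i = mk⇔
  (λ i∈ → does⇒ (P? i) (≡.trans (≡.sym (Vec.lookup∘tabulate (does ∘ P?) i)) (Vec.[]=⇒lookup i∈)))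
  (λ pi → Vec.lookup⇒[]= i _ (≡.trans (Vec.lookup∘tabulate (does ∘ P?) i) (dec-true (P? i) pi)))
  where
  does⇒ : ∀ {q} {Q : Set q} (Q? : Dec Q) → does Q? ≡ true → Q
  does⇒ (yes q) _ = q

-- Linear algebra over a finite field

funToFin-cong : {f g : Fin m → Fin n} → (∀ i → f i ≡ g i) → Fin.funToFin f ≡ Fin.funToFin g
funToFin-cong {zero}  f≗g = ≡.refl
funToFin-cong {suc m} f≗g = ≡.cong₂ Fin.combine (f≗g zero) (funToFin-cong (f≗g ∘ suc))

module FiniteField {q c ℓ} (F : GF q c ℓ) where
  open GF F
  open Inverse enumeration using (to; from; to-cong; strictlyInverseˡ; strictlyInverseʳ)

  label : Carrier → Fin q
  label = to

  scalar : Fin q → Carrier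
  scalar = from

  scalar-label : ∀ x → scalar (label x) ≈ x
  scalar-label = strictlyInverseʳ

  scalar-injective : ∀ {i j} → scalar i ≈ scalar j → i ≡ j
  scalar-injective {i} {j} e = ≡.trans (≡.sym (strictlyInverseˡ i)) (≡.trans (to-cong e) (strictlyInverseˡ j))

  infix 4 _≈?_
  _≈?_ : ∀ x y → Dec (x ≈ y)
  x ≈? y = map′ (λ e → trans (sym (scalar-label x)) (trans (reflexive (≡.cong scalar e)) (scalar-label y)))
                to-cong (to x Fin.≟ to y)

module LinearAlgebra {q c ℓ} (F : GF q c ℓ) (V : VectorSpace F) where
  open GF F using (Carrier; _≈_; 0#; 1#; _+_; _*_; -_)
  private module F = GF F
  open RingProperties F.ring using (-1*x≈-x; +-cancelˡ)
  open FiniteField F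
  open Module V
  open SetoidReasoning ≈ᴹ-setoid
  open CommutativeSemigroupProperties (CommutativeMonoid.commutativeSemigroup +ᴹ-commutativeMonoid) using (interchange)

  lc : ∀ {n} → Vector Carrier n → Vector Carrierᴹ n → Carrierᴹ
  lc = linearCombination F V

  -- Written as a scalar multiple so that closure of a subspace under negation is an instance of
  -- `*ₗ-closed`.
  neg : Carrierᴹ → Carrierᴹ
  neg x = (- 1#) *ₗ x

  neg-inverseˡ : ∀ x → neg x +ᴹ x ≈ᴹ 0ᴹ
  neg-inverseˡ x = begin
    (- 1#) *ₗ x +ᴹ x          ≈⟨ +ᴹ-congˡ (*ₗ-identityˡ x) ⟨
    (- 1#) *ₗ x +ᴹ 1# *ₗ x    ≈⟨ *ₗ-distribʳ x (- 1#) 1# ⟨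
    (- 1# + 1#) *ₗ x          ≈⟨ *ₗ-congʳ (F.-‿inverseˡ 1#) ⟩
    0# *ₗ x                   ≈⟨ *ₗ-zeroˡ x ⟩
    0ᴹ                        ∎

  neg-cancelˡ : ∀ x y → neg x +ᴹ (x +ᴹ y) ≈ᴹ y
  neg-cancelˡ x y = begin
    neg x +ᴹ (x +ᴹ y) ≈⟨ +ᴹ-assoc _ _ _ ⟨
    neg x +ᴹ x +ᴹ y   ≈⟨ +ᴹ-congʳ (neg-inverseˡ x) ⟩
    0ᴹ +ᴹ y           ≈⟨ +ᴹ-identityˡ y ⟩
    y                 ∎

  lc-cong : ∀ {n} {a a′ : Vector Carrier n} (b : Vector Carrierᴹ n) → (∀ i → a i ≈ a′ i) → lc a b ≈ᴹ lc a′ b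
  lc-cong {zero}  b a≈ = ≈ᴹ-refl
  lc-cong {suc n} b a≈ = +ᴹ-cong (*ₗ-congʳ (a≈ zero)) (lc-cong (b ∘ suc) (a≈ ∘ suc))

  lc-+ : ∀ {n} (a a′ : Vector Carrier n) (b : Vector Carrierᴹ n) →
         lc (λ i → a i + a′ i) b ≈ᴹ lc a b +ᴹ lc a′ b
  lc-+ {zero}  a a′ b = ≈ᴹ-sym (+ᴹ-identityˡ 0ᴹ)
  lc-+ {suc n} a a′ b = ≈ᴹ-trans
    (+ᴹ-cong (*ₗ-distribʳ (b zero) (a zero) (a′ zero)) (lc-+ (a ∘ suc) (a′ ∘ suc) (b ∘ suc)))
    (interchange _ _ _ _)

  lc-* : ∀ {n} x (a : Vector Carrier n) (b : Vector Carrierᴹ n) → lc (λ i → x * a i) b ≈ᴹ x *ₗ lc a b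
  lc-* {zero}  x a b = ≈ᴹ-sym (*ₗ-zeroʳ x)
  lc-* {suc n} x a b = ≈ᴹ-trans
    (+ᴹ-cong (*ₗ-assoc x (a zero) (b zero)) (lc-* x (a ∘ suc) (b ∘ suc)))
    (≈ᴹ-sym (*ₗ-distribˡ x _ _))

  lc-0 : ∀ {n} {a : Vector Carrier n} (b : Vector Carrierᴹ n) → (∀ i → a i ≈ 0#) → lc a b ≈ᴹ 0ᴹ
  lc-0 {zero}  b a≈0 = ≈ᴹ-refl
  lc-0 {suc n} b a≈0 = ≈ᴹ-trans
    (+ᴹ-cong (≈ᴹ-trans (*ₗ-congʳ (a≈0 zero)) (*ₗ-zeroˡ (b zero))) (lc-0 (b ∘ suc) (a≈0 ∘ suc)))
    (+ᴹ-identityˡ 0ᴹ)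

  module _ (W : Subspace F V) where
    open Subspace W using (resp; 0ᴹ∈; +ᴹ-closed; *ₗ-closed)

    lc∈ : ∀ {n} (a : Vector Carrier n) {b : Vector Carrierᴹ n} → (∀ i → b i ∈ ⟦ W ⟧) → lc a b ∈ ⟦ W ⟧
    lc∈ {zero}  a b∈W = 0ᴹ∈
    lc∈ {suc n} a b∈W = +ᴹ-closed (*ₗ-closed (a zero) (b∈W zero)) (lc∈ (a ∘ suc) (b∈W ∘ suc))

    +-cancelˡ-∈ : ∀ {x y} → x ∈ ⟦ W ⟧ → x +ᴹ y ∈ ⟦ W ⟧ → y ∈ ⟦ W ⟧
    +-cancelˡ-∈ {x} {y} x∈W x+y∈W = resp (neg-cancelˡ x y) (+ᴹ-closed (*ₗ-closed (- 1#) x∈W) x+y∈W)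

    *ₗ-cancelˡ-∈ : ∀ {a x} → ¬ a ≈ 0# → a *ₗ x ∈ ⟦ W ⟧ → x ∈ ⟦ W ⟧
    *ₗ-cancelˡ-∈ {a} {x} a≉0 ax∈W =
      let (a⁻¹ , aa⁻¹≈1) = F.invertible a a≉0 in
      resp (begin
        a⁻¹ *ₗ a *ₗ x    ≈⟨ *ₗ-assoc a⁻¹ a x ⟨
        (a⁻¹ * a) *ₗ x   ≈⟨ *ₗ-congʳ (F.trans (F.*-comm a⁻¹ a) aa⁻¹≈1) ⟩
        1# *ₗ x          ≈⟨ *ₗ-identityˡ x ⟩
        x                ∎)
        (*ₗ-closed a⁻¹ ax∈W)

    spanned⊆ : ∀ {p n} {X : Pred Carrierᴹ p} {b : Vector Carrierᴹ n} →
               IsBasis F V X b → (∀ i → b i ∈ ⟦ W ⟧) → X ⊆ ⟦ W ⟧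
    spanned⊆ isBasis b∈W x∈X =
      let (a , x≈) = IsBasis.spanning isBasis x∈X in resp (≈ᴹ-sym x≈) (lc∈ a b∈W)

    adjoin : Carrierᴹ → Subspace F V
    adjoin x = record
      { ⟦_⟧       = λ y → ∃[ w ] ∃[ a ] w ∈ ⟦ W ⟧ × y ≈ᴹ w +ᴹ a *ₗ x
      ; resp      = λ y≈z (w , a , w∈W , y≈) → w , a , w∈W , ≈ᴹ-trans (≈ᴹ-sym y≈z) y≈
      ; 0ᴹ∈       = 0ᴹ , 0# , 0ᴹ∈ , ≈ᴹ-sym (≈ᴹ-trans (+ᴹ-identityˡ _) (*ₗ-zeroˡ x))
      ; +ᴹ-closed = λ (w , a , w∈W , y≈) (w′ , a′ , w′∈W , y′≈) →
                    w +ᴹ w′ , a + a′ , +ᴹ-closed w∈W w′∈W ,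
                    ≈ᴹ-trans (+ᴹ-cong y≈ y′≈) (≈ᴹ-trans (interchange _ _ _ _) (+ᴹ-congˡ (≈ᴹ-sym (*ₗ-distribʳ x a a′))))
      ; *ₗ-closed = λ z (w , a , w∈W , y≈) →
                    z *ₗ w , z * a , *ₗ-closed z w∈W ,
                    ≈ᴹ-trans (*ₗ-congˡ y≈) (≈ᴹ-trans (*ₗ-distribˡ z _ _) (+ᴹ-congˡ (≈ᴹ-sym (*ₗ-assoc z a x))))
      }

    ⊆adjoin : ∀ x → ⟦ W ⟧ ⊆ ⟦ adjoin x ⟧
    ⊆adjoin x {w} w∈W = w , 0# , w∈W , ≈ᴹ-sym (≈ᴹ-trans (+ᴹ-congˡ (*ₗ-zeroˡ x)) (+ᴹ-identityʳ w))

    ∈adjoin : ∀ x → x ∈ ⟦ adjoin x ⟧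
    ∈adjoin x = 0ᴹ , 1# , 0ᴹ∈ , ≈ᴹ-sym (≈ᴹ-trans (+ᴹ-identityˡ _) (*ₗ-identityˡ x))

    adjoin⊆ : (X : Subspace F V) → ∀ {x} → ⟦ W ⟧ ⊆ ⟦ X ⟧ → x ∈ ⟦ X ⟧ → ⟦ adjoin x ⟧ ⊆ ⟦ X ⟧
    adjoin⊆ X W⊆X x∈X (w , a , w∈W , y≈) = X.resp (≈ᴹ-sym y≈) (X.+ᴹ-closed (W⊆X w∈W) (X.*ₗ-closed a x∈X))
      where module X = Subspace X

    -- A nonzero coefficient could be divided out, which would put `x` in `W`; equality of scalars
    -- is decidable, so the case split is constructive.
    ∉⇒coefficient≈0 : ∀ {x a} → ¬ x ∈ ⟦ W ⟧ → a *ₗ x ∈ ⟦ W ⟧ → a ≈ 0#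
    ∉⇒coefficient≈0 {a = a} x∉W ax∈W with a ≈? 0#
    ... | yes a≈0 = a≈0
    ... | no  a≉0 = contradiction (*ₗ-cancelˡ-∈ a≉0 ax∈W) x∉W

  -- A basis of the quotient of X by W.
  record IsBasisMod (W : Subspace F V) {p} (X : Pred Carrierᴹ p) {r} (b : Vector Carrierᴹ r)
                    : Set (c ⊔ ℓ ⊔ p) where
    field
      contained   : ∀ i → b i ∈ X
      independent : ∀ a → lc a b ∈ ⟦ W ⟧ → ∀ i → a i ≈ 0#
      spanning    : ∀ {x} → x ∈ X → ∃[ w ] ∃[ a ] w ∈ ⟦ W ⟧ × x ≈ᴹ w +ᴹ lc a b

  zeroSubspace : Subspace F V
  zeroSubspace = record
    { ⟦_⟧       = λ x → Lift c (x ≈ᴹ 0ᴹ)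
    ; resp      = λ x≈y (lift x≈0) → lift (≈ᴹ-trans (≈ᴹ-sym x≈y) x≈0)
    ; 0ᴹ∈       = lift ≈ᴹ-refl
    ; +ᴹ-closed = λ (lift x≈0) (lift y≈0) → lift (≈ᴹ-trans (+ᴹ-cong x≈0 y≈0) (+ᴹ-identityˡ 0ᴹ))
    ; *ₗ-closed = λ a (lift x≈0) → lift (≈ᴹ-trans (*ₗ-congˡ x≈0) (*ₗ-zeroʳ a))
    }

  fullSubspace : Subspace F V
  fullSubspace = record
    { ⟦_⟧       = λ _ → ⊤
    ; resp      = λ _ _ → tt
    ; 0ᴹ∈       = tt
    ; +ᴹ-closed = λ _ _ → tt
    ; *ₗ-closed = λ _ _ → tt
    }

  zeroSubspace⊆ : (W : Subspace F V) → ⟦ zeroSubspace ⟧ ⊆ ⟦ W ⟧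
  zeroSubspace⊆ W (lift x≈0) = Subspace.resp W (≈ᴹ-sym x≈0) (Subspace.0ᴹ∈ W)

  zeroSubspace-dimension : HasDimension F V ⟦ zeroSubspace ⟧ 0
  zeroSubspace-dimension = [] , record
    { contained   = λ ()
    ; independent = λ _ _ ()
    ; spanning    = λ (lift x≈0) → [] , x≈0
    }

  module _ {p} {X : Pred Carrierᴹ p} where

    -- Lets uniqueness of coordinates be proved once, for quotients, and then specialised to
    -- ordinary bases.
    isBasis⇒isBasisMod0 : ∀ {n} {b : Vector Carrierᴹ n} → IsBasis F V X b → IsBasisMod zeroSubspace X b
    isBasis⇒isBasisMod0 isBasis = record
      { contained   = contained
      ; independent = λ a (lift lc≈0) → independent a lc≈0
      ; spanning    = λ x∈X → let (a , x≈) = spanning x∈X in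
                      0ᴹ , a , lift ≈ᴹ-refl , ≈ᴹ-trans x≈ (≈ᴹ-sym (+ᴹ-identityˡ _))
      }
      where open IsBasis isBasis

    isBasis-resp-≐ : ∀ {p′ n} {X′ : Pred Carrierᴹ p′} {b : Vector Carrierᴹ n} →
                     X ≐ X′ → IsBasis F V X b → IsBasis F V X′ b
    isBasis-resp-≐ (X⊆X′ , X′⊆X) isBasis = record
      { contained   = λ i → X⊆X′ (contained i)
      ; independent = independent
      ; spanning    = λ x∈X′ → spanning (X′⊆X x∈X′)
      }
      where open IsBasis isBasis

  adjoin-isBasis : ∀ (W : Subspace F V) {x n} {b : Vector Carrierᴹ n} → ¬ x ∈ ⟦ W ⟧ →
                   IsBasis F V ⟦ W ⟧ b → IsBasis F V ⟦ adjoin W x ⟧ (x ∷ b)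
  adjoin-isBasis W {x} {b = b} x∉W isBasis = record
    { contained   = λ { zero → ∈adjoin W x ; (suc i) → ⊆adjoin W x (contained i) }
    ; independent = indep
    ; spanning    = λ (w , a , w∈W , y≈) → let (as , w≈) = spanning w∈W in
                    a ∷ as , ≈ᴹ-trans y≈ (≈ᴹ-trans (+ᴹ-congʳ w≈) (+ᴹ-comm _ _))
    }
    where
    open IsBasis isBasis
    indep : ∀ a → lc a (x ∷ b) ≈ᴹ 0ᴹ → ∀ i → a i ≈ 0#
    indep a lc≈0 = λ { zero → a₀≈0 ; (suc i) → independent (a ∘ suc) rest≈0 i }
      where
      a₀≈0 : a zero ≈ 0#
      a₀≈0 = ∉⇒coefficient≈0 W x∉W (+-cancelˡ-∈ W (lc∈ W (a ∘ suc) contained)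
               (Subspace.resp W (≈ᴹ-trans (≈ᴹ-sym lc≈0) (+ᴹ-comm _ _)) (Subspace.0ᴹ∈ W)))
      rest≈0 : lc (a ∘ suc) b ≈ᴹ 0ᴹ
      rest≈0 = begin
        lc (a ∘ suc) b                  ≈⟨ +ᴹ-identityˡ _ ⟨
        0ᴹ +ᴹ lc (a ∘ suc) b            ≈⟨ +ᴹ-congʳ (≈ᴹ-trans (*ₗ-congʳ a₀≈0) (*ₗ-zeroˡ x)) ⟨
        a zero *ₗ x +ᴹ lc (a ∘ suc) b   ≈⟨ lc≈0 ⟩
        0ᴹ                              ∎

  adjoin-isBasisMod : ∀ (W : Subspace F V) {x p r} {X : Pred Carrierᴹ p} {b : Vector Carrierᴹ r} →
                      x ∈ X → ¬ x ∈ ⟦ W ⟧ → IsBasisMod (adjoin W x) X b → IsBasisMod W X (x ∷ b)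
  adjoin-isBasisMod W {x} {b = b} x∈X x∉W isBasisMod = record
    { contained   = λ { zero → x∈X ; (suc i) → contained i }
    ; independent = indep
    ; spanning    = λ y∈X → let (u , as , (w , a , w∈W , u≈) , y≈) = spanning y∈X in
                    w , a ∷ as , w∈W , ≈ᴹ-trans y≈ (≈ᴹ-trans (+ᴹ-congʳ u≈) (+ᴹ-assoc _ _ _))
    }
    where
    open IsBasisMod isBasisMod
    module W+x = Subspace (adjoin W x)
    indep : ∀ a → lc a (x ∷ b) ∈ ⟦ W ⟧ → ∀ i → a i ≈ 0#
    indep a lc∈W = λ { zero → ∉⇒coefficient≈0 W x∉W a₀x∈W ; (suc i) → rest≈0 i }
      where
      rest≈0 : ∀ i → a (suc i) ≈ 0#
      rest≈0 = independent (a ∘ suc) (+-cancelˡ-∈ (adjoin W x) (W+x.*ₗ-closed (a zero) (∈adjoin W x)) (⊆adjoin W x lc∈W))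
      a₀x∈W : a zero *ₗ x ∈ ⟦ W ⟧
      a₀x∈W = Subspace.resp W (≈ᴹ-trans (+ᴹ-congˡ (lc-0 b rest≈0)) (+ᴹ-identityʳ _)) lc∈W

  -- The base-q digits of an index are read as labels of scalars, so the indices below q^r enumerate
  -- all coefficient tuples of length r.
  vec : ∀ {r} → Vector Carrierᴹ r → Fin (q ℕ.^ r) → Carrierᴹ
  vec b i = lc (scalar ∘ Fin.finToFun i) b

  code : ∀ {r} → Vector Carrier r → Fin (q ℕ.^ r)
  code a = Fin.funToFin (label ∘ a)

  vec-code : ∀ {r} (a : Vector Carrier r) b → vec b (code a) ≈ᴹ lc a b
  vec-code a b = lc-cong b λ i →
    F.trans (F.reflexive (≡.cong scalar (Fin.finToFun-funToFin (label ∘ a) i))) (scalar-label (a i))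

  module Mod {W : Subspace F V} {p} {X : Pred Carrierᴹ p} {r} {b : Vector Carrierᴹ r}
             (isBasisMod : IsBasisMod W X b) where
    open IsBasisMod isBasisMod

    -- The combination with coefficients `s k - t k` lies in `W`, so independence modulo `W` makes
    -- every difference vanish.
    lc-injective : ∀ {w s t} → w ∈ ⟦ W ⟧ → lc s b ≈ᴹ w +ᴹ lc t b → ∀ k → s k ≈ t k
    lc-injective {w} {s} {t} w∈W e k =
      +-cancelˡ (- t k) (s k) (t k) (F.trans (F.+-congʳ (F.sym (-1*x≈-x (t k))))
        (F.trans (independent _ difference∈W k) (F.sym (F.-‿inverseˡ (t k)))))
      where
      difference∈W : lc (λ k → (- 1#) * t k + s k) b ∈ ⟦ W ⟧
      difference∈W = Subspace.resp W (begin
        w                                          ≈⟨ neg-cancelˡ (lc t b) w ⟨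
        neg (lc t b) +ᴹ (lc t b +ᴹ w)              ≈⟨ +ᴹ-congˡ (≈ᴹ-trans e (+ᴹ-comm _ _)) ⟨
        neg (lc t b) +ᴹ lc s b                     ≈⟨ +ᴹ-congʳ (lc-* (- 1#) t b) ⟨
        lc (λ k → (- 1#) * t k) b +ᴹ lc s b        ≈⟨ lc-+ (λ k → (- 1#) * t k) s b ⟨
        lc (λ k → (- 1#) * t k + s k) b            ∎) w∈W

    vec-injective : ∀ {w i j} → w ∈ ⟦ W ⟧ → vec b i ≈ᴹ w +ᴹ vec b j → i ≡ j
    vec-injective {i = i} {j} w∈W e = ≡.trans (≡.sym (Fin.funToFin-finToFin {r} {q} i))
      (≡.trans (funToFin-cong λ k → scalar-injective (lc-injective w∈W e k)) (Fin.funToFin-finToFin {r} {q} j))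

    vec-surjective : ∀ {x} → x ∈ X → ∃[ w ] ∃[ i ] w ∈ ⟦ W ⟧ × x ≈ᴹ w +ᴹ vec b i
    vec-surjective x∈X = let (w , a , w∈W , x≈) = spanning x∈X in
      w , code a , w∈W , ≈ᴹ-trans x≈ (+ᴹ-congˡ (≈ᴹ-sym (vec-code a b)))

  module Basis {p} {X : Pred Carrierᴹ p} {n} {b : Vector Carrierᴹ n} (isBasis : IsBasis F V X b) where
    open IsBasis isBasis

    vec-injective : ∀ {i j} → vec b i ≈ᴹ vec b j → i ≡ j
    vec-injective e = Mod.vec-injective (isBasis⇒isBasisMod0 isBasis) (lift ≈ᴹ-refl)
                        (≈ᴹ-trans e (≈ᴹ-sym (+ᴹ-identityˡ _)))

    vec-surjective : ∀ {x} → x ∈ X → ∃[ i ] x ≈ᴹ vec b i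
    vec-surjective x∈X = let (a , x≈) = spanning x∈X in code a , ≈ᴹ-trans x≈ (≈ᴹ-sym (vec-code a b))

  module _ {{pp : PrimePower q}} where

    -- Counting replaces the exchange lemma: expressing the q^m combinations of the basis of `X` in
    -- the basis of `W` is an injection into q^n indices, which is impossible for n < m since q > 1.
    dimension-mono : (W : Subspace F V) → ∀ {p} {X : Pred Carrierᴹ p} {m n} →
                     HasDimension F V X m → HasDimension F V ⟦ W ⟧ n → X ⊆ ⟦ W ⟧ → m ℕ.≤ n
    dimension-mono W {X = X} {m} {n} (b , b-isBasis) (d , d-isBasis) X⊆W = ℕ.≮⇒≥ λ n<m →
        ℕ.<⇒≱ (ℕ.^-monoʳ-< q (ℕ.nonTrivial⇒n>1 q) n<m) (Fin.injective⇒≤ index-injective)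
      where
      instance _ = primePower⇒nonTrivial pp
      index : ∀ i → ∃[ j ] vec b i ≈ᴹ vec d j
      index i = Basis.vec-surjective d-isBasis (lc∈ W _ (X⊆W ∘ IsBasis.contained b-isBasis))
      index-injective : Injective _≡_ _≡_ (proj₁ ∘ index)
      index-injective {i} {j} e = Basis.vec-injective b-isBasis
        (≈ᴹ-trans (proj₂ (index i))
        (≈ᴹ-trans (≈ᴹ-reflexive (≡.cong (vec d) e)) (≈ᴹ-sym (proj₂ (index j)))))

    dimension-unique : (W : Subspace F V) → ∀ {m n} →
                       HasDimension F V ⟦ W ⟧ m → HasDimension F V ⟦ W ⟧ n → m ≡ n
    dimension-unique W dm dn =
      ℕ.≤-antisym (dimension-mono W dm dn (λ x∈ → x∈)) (dimension-mono W dn dm (λ x∈ → x∈))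

  module FiniteDimensional {n} (dim-V : HasDimension F V U n) where
    private
      e : Vector Carrierᴹ n
      e = proj₁ dim-V
      module E = Basis (proj₂ dim-V)

    vector : Fin (q ℕ.^ n) → Carrierᴹ
    vector = vec e

    vector-injective : ∀ {i j} → vector i ≈ᴹ vector j → i ≡ j
    vector-injective = E.vec-injective

    vector-surjective : ∀ x → ∃[ i ] x ≈ᴹ vector i
    vector-surjective x = E.vec-surjective _

    infix 4 _≈ᴹ?_
    _≈ᴹ?_ : ∀ x y → Dec (x ≈ᴹ y)
    x ≈ᴹ? y with vector-surjective x | vector-surjective y
    ... | i , x≈ | j , y≈ = map′
      (λ i≡j → ≈ᴹ-trans x≈ (≈ᴹ-trans (≈ᴹ-reflexive (≡.cong vector i≡j)) (≈ᴹ-sym y≈)))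
      (λ x≈y → vector-injective (≈ᴹ-trans (≈ᴹ-sym x≈) (≈ᴹ-trans x≈y y≈)))
      (i Fin.≟ j)

    module _ (W : Subspace F V) {d} (dim-W : HasDimension F V ⟦ W ⟧ d) where
      private
        b : Vector Carrierᴹ d
        b = proj₁ dim-W
        module B = Basis (proj₂ dim-W)
        open IsBasis (proj₂ dim-W)

      opaque
        -- A search through the finitely many combinations of a basis of `W`, each compared with `x`
        -- by its position in the enumeration of the whole space.
        member? : ∀ x → Dec (x ∈ ⟦ W ⟧)
        member? x = map′ (λ (i , x≈) → Subspace.resp W (≈ᴹ-sym x≈) (lc∈ W _ contained))
                         B.vec-surjective
                         (Fin.any? λ i → x ≈ᴹ? vec b i)

        -- Only the basis vectors of `X` need testing, since `W` is closed under linear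
        -- combinations.
        contains? : ∀ {p m} {X : Pred Carrierᴹ p} → HasDimension F V X m → Dec (X ⊆ ⟦ W ⟧)
        contains? (g , g-isBasis) = map′ (λ g∈W → spanned⊆ W g-isBasis g∈W)
                                         (λ X⊆W i → X⊆W (IsBasis.contained g-isBasis i))
                                         (Fin.all? λ i → member? (g i))

      count-vectors : count (member? ∘ vector) ≡ q ℕ.^ d
      count-vectors = count-image (member? ∘ vector) (proj₁ ∘ index) index-injective
        (λ i → Subspace.resp W (proj₂ (index i)) (lc∈ W _ contained))
        λ i vi∈W → let (j , vi≈) = B.vec-surjective vi∈W in
          j , vector-injective (≈ᴹ-trans (≈ᴹ-sym (proj₂ (index j))) (≈ᴹ-sym vi≈))
        where
        index : ∀ i → ∃[ j ] vec b i ≈ᴹ vector j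
        index i = vector-surjective (vec b i)
        index-injective : Injective _≡_ _≡_ (proj₁ ∘ index)
        index-injective {i} {j} eq = B.vec-injective
          (≈ᴹ-trans (proj₂ (index i))
          (≈ᴹ-trans (≈ᴹ-reflexive (≡.cong vector eq)) (≈ᴹ-sym (proj₂ (index j)))))

    -- Greedy extension: each vector of a list exhausting X is adjoined
    -- unless it already lies in the span.
    extend : (X : Subspace F V) → (∀ x → Dec (x ∈ ⟦ X ⟧)) →
             ∀ m (y : Vector Carrierᴹ m) →
             ∀ (W : Subspace F V) {d} → HasDimension F V ⟦ W ⟧ d → ⟦ W ⟧ ⊆ ⟦ X ⟧ →
             (∀ {x} → x ∈ ⟦ X ⟧ → x ∈ ⟦ W ⟧ ⊎ ∃[ i ] x ≈ᴹ y i) →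
             ∃[ r ] (Σ[ b ∈ Vector Carrierᴹ r ] IsBasisMod W ⟦ X ⟧ b) × HasDimension F V ⟦ X ⟧ (r ℕ.+ d)
    extend X X? zero y W {d} (b , b-isBasis) W⊆X cover =
      -- With the list exhausted, `cover` yields `X ⊆ W`, and the empty family is a basis modulo
      -- `W`.
      0 , ([] , record
        { contained   = λ ()
        ; independent = λ _ _ ()
        ; spanning    = λ {x} x∈X → x , [] , X⊆W x∈X , ≈ᴹ-sym (+ᴹ-identityʳ x)
        }) , b , isBasis-resp-≐ (W⊆X , X⊆W) b-isBasis
      where
      X⊆W : ⟦ X ⟧ ⊆ ⟦ W ⟧
      X⊆W x∈X with cover x∈X
      ... | inj₁ x∈W = x∈W
    extend X X? (suc m) y W {d} dim-W W⊆X cover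
      with X? (y zero) | member? W dim-W (y zero)
    ... | yes y∈X | no y∉W =
      let (r , (b , b-isBasisMod) , dim-X) =
            extend X X? m (y ∘ suc) (adjoin W (y zero))
              (y zero ∷ proj₁ dim-W , adjoin-isBasis W y∉W (proj₂ dim-W))
              (adjoin⊆ W X W⊆X y∈X) λ x∈X → later (cover x∈X)
      in suc r , (y zero ∷ b , adjoin-isBasisMod W y∈X y∉W b-isBasisMod) ,
         ≡.subst (HasDimension F V ⟦ X ⟧) (ℕ.+-suc r d) dim-X
      where
      later : ∀ {x} → x ∈ ⟦ W ⟧ ⊎ (∃[ i ] x ≈ᴹ y i) → x ∈ ⟦ adjoin W (y zero) ⟧ ⊎ ∃[ i ] x ≈ᴹ y (suc i)
      later (inj₁ x∈W)          = inj₁ (⊆adjoin W (y zero) x∈W)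
      later (inj₂ (zero , x≈))  = inj₁ (Subspace.resp (adjoin W (y zero)) (≈ᴹ-sym x≈) (∈adjoin W (y zero)))
      later (inj₂ (suc i , x≈)) = inj₂ (i , x≈)
    ... | _ | yes y∈W = extend X X? m (y ∘ suc) W dim-W W⊆X λ x∈X → later (cover x∈X)
      where
      later : ∀ {x} → x ∈ ⟦ W ⟧ ⊎ (∃[ i ] x ≈ᴹ y i) → x ∈ ⟦ W ⟧ ⊎ ∃[ i ] x ≈ᴹ y (suc i)
      later (inj₁ x∈W)          = inj₁ x∈W
      later (inj₂ (zero , x≈))  = inj₁ (Subspace.resp W (≈ᴹ-sym x≈) y∈W)
      later (inj₂ (suc i , x≈)) = inj₂ (i , x≈)
    ... | no y∉X | _ = extend X X? m (y ∘ suc) W dim-W W⊆X λ x∈X → later x∈X (cover x∈X)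
      where
      later : ∀ {x} → x ∈ ⟦ X ⟧ → x ∈ ⟦ W ⟧ ⊎ (∃[ i ] x ≈ᴹ y i) → x ∈ ⟦ W ⟧ ⊎ ∃[ i ] x ≈ᴹ y (suc i)
      later x∈X (inj₁ x∈W)          = inj₁ x∈W
      later x∈X (inj₂ (zero , x≈))  = contradiction (Subspace.resp X x≈ x∈X) y∉X
      later x∈X (inj₂ (suc i , x≈)) = inj₂ (i , x≈)

    opaque
      complement : (W X : Subspace F V) → (∀ x → Dec (x ∈ ⟦ X ⟧)) →
                   ∀ {d} → HasDimension F V ⟦ W ⟧ d → ⟦ W ⟧ ⊆ ⟦ X ⟧ →
                   ∃[ r ] (Σ[ b ∈ Vector Carrierᴹ r ] IsBasisMod W ⟦ X ⟧ b) × HasDimension F V ⟦ X ⟧ (r ℕ.+ d)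
      complement W X X? dim-W W⊆X =
        extend X X? _ vector W dim-W W⊆X λ {x} _ → inj₂ (vector-surjective x)

      dimension : (X : Subspace F V) → (∀ x → Dec (x ∈ ⟦ X ⟧)) → ∃[ d ] HasDimension F V ⟦ X ⟧ d
      dimension X X? = let (r , _ , dim-X) = complement zeroSubspace X X? zeroSubspace-dimension (zeroSubspace⊆ X)
                       in r ℕ.+ 0 , dim-X

-- Linear maps

module _ {q c ℓ} {F : GF q c ℓ} where

  open GF F using (Carrier)
  private module F = GF F

  record Linear (V V′ : VectorSpace F) (f : Module.Carrierᴹ V → Module.Carrierᴹ V′) : Set (c ⊔ ℓ) where
    private
      module V  = Module V
      module V′ = Module V′
    field
      cong    : ∀ {x y} → x V.≈ᴹ y → f x V′.≈ᴹ f y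
      +-homo  : ∀ x y → f (x V.+ᴹ y) V′.≈ᴹ f x V′.+ᴹ f y
      *ₗ-homo : ∀ a x → f (a V.*ₗ x) V′.≈ᴹ a V′.*ₗ f x

    0-homo : f V.0ᴹ V′.≈ᴹ V′.0ᴹ
    0-homo = V′.≈ᴹ-trans (cong (V.≈ᴹ-sym (V.*ₗ-zeroˡ V.0ᴹ))) (V′.≈ᴹ-trans (*ₗ-homo F.0# V.0ᴹ) (V′.*ₗ-zeroˡ _))

    lc-homo : ∀ {n} (a : Vector Carrier n) b → f (linearCombination F V a b) V′.≈ᴹ linearCombination F V′ a (f ∘ b)
    lc-homo {zero}  a b = 0-homo
    lc-homo {suc n} a b = V′.≈ᴹ-trans (+-homo _ _) (V′.+ᴹ-cong (*ₗ-homo _ _) (lc-homo (a ∘ suc) (b ∘ suc)))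

    preimage : Subspace F V′ → Subspace F V
    preimage W = record
      { ⟦_⟧       = λ x → f x ∈ ⟦ W ⟧
      ; resp      = λ x≈y → W.resp (cong x≈y)
      ; 0ᴹ∈       = W.resp (V′.≈ᴹ-sym 0-homo) W.0ᴹ∈
      ; +ᴹ-closed = λ x∈ y∈ → W.resp (V′.≈ᴹ-sym (+-homo _ _)) (W.+ᴹ-closed x∈ y∈)
      ; *ₗ-closed = λ a x∈ → W.resp (V′.≈ᴹ-sym (*ₗ-homo a _)) (W.*ₗ-closed a x∈)
      }
      where module W = Subspace W

    -- The three hypotheses make `f` a bijection from `W` onto `W′` up to equality: the trivial
    -- kernel carries independence over, surjectivity carries spanning.
    image-isBasis : (W : Subspace F V) → ∀ {p n} {W′ : Pred V′.Carrierᴹ p} {b : Vector V.Carrierᴹ n} →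
                    (∀ {x} → x ∈ ⟦ W ⟧ → f x ∈ W′) →
                    (∀ {x} → x ∈ ⟦ W ⟧ → f x V′.≈ᴹ V′.0ᴹ → x V.≈ᴹ V.0ᴹ) →
                    (∀ {y} → y ∈ W′ → ∃[ x ] x ∈ ⟦ W ⟧ × y V′.≈ᴹ f x) →
                    IsBasis F V ⟦ W ⟧ b → IsBasis F V′ W′ (f ∘ b)
    image-isBasis W {b = b} into kernel onto isBasis = record
      { contained   = λ i → into (contained i)
      ; independent = λ a lc≈0 → independent a
          (kernel (LinearAlgebra.lc∈ F V W a contained) (V′.≈ᴹ-trans (lc-homo a b) lc≈0))
      ; spanning    = λ y∈W′ → let (x , x∈W , y≈) = onto y∈W′
                                   (a , x≈)       = spanning x∈W
                               in a , V′.≈ᴹ-trans y≈ (V′.≈ᴹ-trans (cong x≈) (lc-homo a b))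
      }
      where open IsBasis isBasis

  module Coordinates {V V′ : VectorSpace F} {n}
                     (dim-V : HasDimension F V U n) (dim-V′ : HasDimension F V′ U n) where
    private
      module V  = Module V
      module V′ = Module V′
      module L  = LinearAlgebra F V
      module L′ = LinearAlgebra F V′
      b  = proj₁ dim-V
      b′ = proj₁ dim-V′
      open IsBasis (proj₂ dim-V)

    coordinates : V.Carrierᴹ → Vector Carrier n
    coordinates x = proj₁ (spanning {x} _)

    coordinates-lc : ∀ x → x V.≈ᴹ L.lc (coordinates x) b
    coordinates-lc x = proj₂ (spanning {x} _)

    coordinates-unique : ∀ {x a} → x V.≈ᴹ L.lc a b → ∀ i → coordinates x i F.≈ a i
    coordinates-unique {x} x≈ = L.Mod.lc-injective (L.isBasis⇒isBasisMod0 (proj₂ dim-V)) (lift V.≈ᴹ-refl)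
      (V.≈ᴹ-trans (V.≈ᴹ-sym (coordinates-lc x)) (V.≈ᴹ-trans x≈ (V.≈ᴹ-sym (V.+ᴹ-identityˡ _))))

    -- The isomorphism that matches the two chosen bases.
    transport : V.Carrierᴹ → V′.Carrierᴹ
    transport x = L′.lc (coordinates x) b′

    transport-linear : Linear V V′ transport
    transport-linear = record
      { cong    = λ {x} {y} x≈y → L′.lc-cong b′ (coordinates-unique (V.≈ᴹ-trans x≈y (coordinates-lc y)))
      ; +-homo  = λ x y → V′.≈ᴹ-trans
          (L′.lc-cong b′ (coordinates-unique
            (V.≈ᴹ-trans (V.+ᴹ-cong (coordinates-lc x) (coordinates-lc y)) (V.≈ᴹ-sym (L.lc-+ _ _ b)))))
          (L′.lc-+ _ _ b′)
      ; *ₗ-homo = λ a x → V′.≈ᴹ-trans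
          (L′.lc-cong b′ (coordinates-unique
            (V.≈ᴹ-trans (V.*ₗ-congˡ (coordinates-lc x)) (V.≈ᴹ-sym (L.lc-* a _ b)))))
          (L′.lc-* a _ b′)
      }

  transport-inverse : ∀ {V V′ : VectorSpace F} {n}
    (dim-V : HasDimension F V U n) (dim-V′ : HasDimension F V′ U n) → ∀ x →
    Module._≈ᴹ_ V (Coordinates.transport {V′} {V} dim-V′ dim-V (Coordinates.transport {V} {V′} dim-V dim-V′ x)) x
  transport-inverse {V} {V′} dim-V dim-V′ x = V.≈ᴹ-trans
    (L.lc-cong _ (C′.coordinates-unique V′.≈ᴹ-refl)) (V.≈ᴹ-sym (C.coordinates-lc x))
    where
    module V  = Module V
    module V′ = Module V′
    module L  = LinearAlgebra F V
    module C  = Coordinates {V} {V′} dim-V dim-V′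
    module C′ = Coordinates {V′} {V} dim-V′ dim-V

  -- The derived and the residual design come with unrelated spaces of equal dimension. Blocks are
  -- pulled back along the isomorphism `φ` and test subspaces along its inverse `ψ`, so containments
  -- correspond. Preimages serve in place of images because they are again subspaces by mere
  -- composition.
  transfer : ∀ {V V′ : VectorSpace F} {P} → HasDimension F V′ U (Parameters.v P) →
             SubspaceDesign F V P → SubspaceDesign F V′ P
  transfer {V} {V′} {P} dim-V′ D = record
    { dim-V          = dim-V′
    ; size           = size
    ; block          = Φ.preimage ∘ block
    ; block-distinct = λ {i} {j} (i⊆j , j⊆i) → block-distinct
        ( (λ x∈ → Subspace.resp (block j) (φψ _) (i⊆j (Subspace.resp (block i) (V.≈ᴹ-sym (φψ _)) x∈)))
        , (λ x∈ → Subspace.resp (block i) (φψ _) (j⊆i (Subspace.resp (block j) (V.≈ᴹ-sym (φψ _)) x∈))))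
    ; block-dim      = λ i → let (b , b-isBasis) = block-dim i in ψ ∘ b ,
        Ψ.image-isBasis (block i)
          (λ x∈ → Subspace.resp (block i) (V.≈ᴹ-sym (φψ _)) x∈)
          (λ _ ψx≈0 → V.≈ᴹ-trans (V.≈ᴹ-sym (φψ _)) (V.≈ᴹ-trans (Linear.cong Φ-linear ψx≈0) Φ.0-homo))
          (λ y∈ → φ _ , y∈ , V′.≈ᴹ-sym (ψφ _)) b-isBasis
    ; balanced       = λ T (b , b-isBasis) →
        let (S , S⇔ , ∣S∣≡λ) = balanced (Ψ.preimage T) (φ ∘ b ,
              Φ.image-isBasis T
                (λ x∈ → Subspace.resp T (V′.≈ᴹ-sym (ψφ _)) x∈)
                (λ _ φx≈0 → V′.≈ᴹ-trans (V′.≈ᴹ-sym (ψφ _)) (V′.≈ᴹ-trans (Linear.cong Ψ-linear φx≈0) Ψ.0-homo))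
                (λ y∈ → ψ _ , y∈ , V.≈ᴹ-sym (φψ _)) b-isBasis)
        in S , (λ i → preimage⊆⇔ T (block i) ⇔-∘ S⇔ i)
           , ∣S∣≡λ
    }
    where
    module V  = Module V
    module V′ = Module V′
    open SubspaceDesign D
    φ : V′.Carrierᴹ → V.Carrierᴹ
    φ = Coordinates.transport {V′} {V} dim-V′ dim-V
    ψ : V.Carrierᴹ → V′.Carrierᴹ
    ψ = Coordinates.transport {V} {V′} dim-V dim-V′
    Φ-linear : Linear V′ V φ
    Φ-linear = Coordinates.transport-linear {V′} {V} dim-V′ dim-V
    Ψ-linear : Linear V V′ ψ
    Ψ-linear = Coordinates.transport-linear {V} {V′} dim-V dim-V′
    module Φ = Linear Φ-linear
    module Ψ = Linear Ψ-linear
    φψ : ∀ x → φ (ψ x) V.≈ᴹ x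
    φψ = transport-inverse {V} {V′} dim-V dim-V′
    ψφ : ∀ x → ψ (φ x) V′.≈ᴹ x
    ψφ = transport-inverse {V′} {V} dim-V′ dim-V
    preimage⊆⇔ : ∀ T B → (⟦ Ψ.preimage T ⟧ ⊆ ⟦ B ⟧) ⇔ (⟦ T ⟧ ⊆ ⟦ Φ.preimage B ⟧)
    preimage⊆⇔ T B = record
      { to        = λ φT⊆ x∈T → φT⊆ (Subspace.resp T (V′.≈ᴹ-sym (ψφ _)) x∈T)
      ; from      = λ T⊆ x∈ → Subspace.resp B (φψ _) (T⊆ x∈)
      ; to-cong   = λ { ≡.refl → ≡.refl }
      ; from-cong = λ { ≡.refl → ≡.refl }
      }

-- Double counting

𝟙-× : ∀ {p₁ p₂ p₃} {P : Set p₁} {Q : Set p₂} {R : Set p₃} (P? : Dec P) (Q? : Dec Q) (R? : Dec R) →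
      (P × Q) ⇔ R → 𝟙 P? ℕ.* 𝟙 Q? ≡ 𝟙 R?
𝟙-× P? Q? R? PQ⇔R with P? | Q?
... | yes p | yes q = ≡.sym (𝟙-yes R? (Equivalence.to PQ⇔R (p , q)))
... | yes p | no ¬q = ≡.sym (𝟙-no R? (¬q ∘ proj₂ ∘ Equivalence.from PQ⇔R))
... | no ¬p | _     = ≡.sym (𝟙-no R? (¬p ∘ proj₁ ∘ Equivalence.from PQ⇔R))

-- Dividing the double count by q^d leaves `a + N * q ^ k ≡ N + a * q ^ n`. Taking `a + N` away from
-- both sides produces the two factors; the hypothesis is additive so that truncated subtraction
-- enters only here, where it is exact.
cancel-^ : ∀ {q N a} d k n .{{_ : ℕ.NonZero q}} →
  N ℕ.* q ℕ.^ (k ℕ.+ d) ℕ.+ q ℕ.^ d ℕ.* a ≡ q ℕ.^ d ℕ.* N ℕ.+ q ℕ.^ (n ℕ.+ d) ℕ.* a →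
  N ℕ.* (q ℕ.^ k ℕ.∸ 1) ≡ a ℕ.* (q ℕ.^ n ℕ.∸ 1)
cancel-^ {q} {N} {a} d k n e = begin
  N * (q ^ k ∸ 1)                           ≡⟨ ∸-1 N (q ^ k) ⟩
  N * q ^ k ∸ N                             ≡⟨ ℕ.[m+n]∸[m+o]≡n∸o a (N * q ^ k) N ⟨
  a + N * q ^ k ∸ (a + N)                   ≡⟨ ≡.cong (_∸ (a + N)) reduced-e ⟩
  N + a * q ^ n ∸ (a + N)                   ≡⟨ ≡.cong (N + a * q ^ n ∸_) (ℕ.+-comm a N) ⟩
  N + a * q ^ n ∸ (N + a)                   ≡⟨ ℕ.[m+n]∸[m+o]≡n∸o N (a * q ^ n) a ⟩
  a * q ^ n ∸ a                             ≡⟨ ∸-1 a (q ^ n) ⟨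
  a * (q ^ n ∸ 1)                           ∎
  where
  open ≡.≡-Reasoning
  open import Data.Nat.Base using (_+_; _*_; _∸_; _^_)
  ∸-1 : ∀ x y → x * (y ∸ 1) ≡ x * y ∸ x
  ∸-1 x y = ≡.trans (ℕ.*-distribˡ-∸ x y 1) (≡.cong (x * y ∸_) (ℕ.*-identityʳ x))
  factorˡ : ∀ N a Q D → D * (a + N * Q) ≡ N * (Q * D) + D * a
  factorˡ = solve-∀
  factorʳ : ∀ N a Q D → D * N + Q * D * a ≡ D * (N + a * Q)
  factorʳ = solve-∀
  instance _ = ℕ.m^n≢0 q d
  reduced-e : a + N * q ^ k ≡ N + a * q ^ n
  reduced-e = ℕ.*-cancelˡ-≡ _ _ (q ^ d) (begin
    q ^ d * (a + N * q ^ k)             ≡⟨ factorˡ N a (q ^ k) (q ^ d) ⟩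
    N * (q ^ k * q ^ d) + q ^ d * a     ≡⟨ ≡.cong (λ z → N * z + q ^ d * a) (ℕ.^-distribˡ-+-* q k d) ⟨
    N * q ^ (k + d) + q ^ d * a         ≡⟨ e ⟩
    q ^ d * N + q ^ (n + d) * a         ≡⟨ ≡.cong (λ z → q ^ d * N + z * a) (ℕ.^-distribˡ-+-* q n d) ⟩
    q ^ d * N + q ^ n * q ^ d * a       ≡⟨ factorʳ N a (q ^ n) (q ^ d) ⟩
    q ^ d * (N + a * q ^ n)             ∎)

-- The bridge between counts and the fractional parameters. It passes through unnormalised
-- rationals, whose equality is cross multiplication by definition.
/1-*⇔ : ∀ N a c d .{{_ : ℕ.NonZero d}} →
        (ℤ.+ N ℚ./ 1 ≡ (ℤ.+ a ℚ./ 1) ℚ.* (ℤ.+ c ℚ./ d)) ⇔ (N ℕ.* d ≡ a ℕ.* c)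
/1-*⇔ N a c (suc d) = mk⇔
  (λ e → ℤ.+-injective (≡.trans (≡.sym numeratorˡ) (≡.trans
    (ℚᵘ.drop-*≡* (ℚᵘ.≃-trans (ℚᵘ.≃-sym (ℚ.toℚᵘ-fromℚᵘ N/1)) (ℚᵘ.≃-trans (ℚ.toℚᵘ-cong e) product≃)))
    numeratorʳ)))
  (λ e → ℚ.toℚᵘ-injective (ℚᵘ.≃-trans (ℚ.toℚᵘ-fromℚᵘ N/1) (ℚᵘ.≃-trans
    (ℚᵘ.*≡* (≡.trans numeratorˡ (≡.trans (≡.cong ℤ.+_ e) (≡.sym numeratorʳ))))
    (ℚᵘ.≃-sym product≃))))
  where
  N/1 a/1 c/d : ℚᵘ.ℚᵘ
  N/1 = ℚᵘ.mkℚᵘ (ℤ.+ N) 0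
  a/1 = ℚᵘ.mkℚᵘ (ℤ.+ a) 0
  c/d = ℚᵘ.mkℚᵘ (ℤ.+ c) d
  product≃ : ℚ.toℚᵘ ((ℤ.+ a ℚ./ 1) ℚ.* (ℤ.+ c ℚ./ suc d)) ℚᵘ.≃ a/1 ℚᵘ.* c/d
  product≃ = ℚᵘ.≃-trans (ℚ.toℚᵘ-homo-* (ℤ.+ a ℚ./ 1) (ℤ.+ c ℚ./ suc d))
                        (ℚᵘ.*-cong (ℚ.toℚᵘ-fromℚᵘ a/1) (ℚ.toℚᵘ-fromℚᵘ c/d))
  numeratorˡ : ℤ.+ N ℤ.* ℤ.+ (1 ℕ.* suc d) ≡ ℤ.+ (N ℕ.* suc d)
  numeratorˡ = ≡.trans (≡.sym (ℤ.pos-* N (1 ℕ.* suc d))) (≡.cong (λ z → ℤ.+ (N ℕ.* z)) (ℕ.*-identityˡ (suc d)))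
  numeratorʳ : ℤ.+ a ℤ.* ℤ.+ c ℤ.* ℤ.+ 1 ≡ ℤ.+ (a ℕ.* c)
  numeratorʳ = ≡.trans (ℤ.*-identityʳ (ℤ.+ a ℤ.* ℤ.+ c)) (≡.sym (ℤ.pos-* a c))

/1-injective : ∀ m n → ℤ.+ m ℚ./ 1 ≡ ℤ.+ n ℚ./ 1 → m ≡ n
/1-injective m n e = ℤ.+-injective (≡.trans (≡.sym (ℤ.*-identityʳ (ℤ.+ m))) (≡.trans
  (ℚᵘ.drop-*≡* (ℚᵘ.≃-trans (ℚᵘ.≃-sym (ℚ.toℚᵘ-fromℚᵘ (ℚᵘ.mkℚᵘ (ℤ.+ m) 0)))
    (ℚᵘ.≃-trans (ℚ.toℚᵘ-cong e) (ℚ.toℚᵘ-fromℚᵘ (ℚᵘ.mkℚᵘ (ℤ.+ n) 0)))))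
  (ℤ.*-identityʳ (ℤ.+ n))))

module Blocks {q c ℓ} {F : GF q c ℓ} {V : VectorSpace F} {n} (dim-V : HasDimension F V U n)
              {size} (block : Fin size → Subspace F V)
              {k} (block-dim : ∀ i → HasDimension F V ⟦ block i ⟧ k) where
  open Module V using (Carrierᴹ)
  open LinearAlgebra F V
  open FiniteDimensional dim-V

  containing : ∀ {p d} {X : Pred Carrierᴹ p} → HasDimension F V X d → ℕ
  containing dim-X = count (λ i → contains? (block i) (block-dim i) dim-X)

  -- Counts the pairs of a vector x and a block containing both W and x.
  double-count : ∀ (W : Subspace F V) {d} (dim-W : HasDimension F V ⟦ W ⟧ d) {a} →
    (∀ x (x∉W : ¬ x ∈ ⟦ W ⟧) → containing (x ∷ proj₁ dim-W , adjoin-isBasis W x∉W (proj₂ dim-W)) ≡ a) →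
    containing dim-W ℕ.* q ℕ.^ k ℕ.+ q ℕ.^ d ℕ.* a ≡ q ℕ.^ d ℕ.* containing dim-W ℕ.+ q ℕ.^ n ℕ.* a
  double-count W {d} dim-W {a} regular = begin
    N * q ^ k + q ^ d * a
      ≡⟨ ≡.cong₂ _+_ by-block (≡.cong (_* a) (≡.sym (count-vectors W dim-W))) ⟩
    (∑[ x < q ^ n ] through x) + count (inW? ∘ vector) * a
      ≡⟨ ≡.cong ((∑[ x < q ^ n ] through x) +_) (*-distribʳ-sum a (λ x → 𝟙 (inW? (vector x)))) ⟩
    (∑[ x < q ^ n ] through x) + (∑[ x < q ^ n ] (𝟙 (inW? (vector x)) * a))
      ≡⟨ ∑-distrib-+ through (λ x → 𝟙 (inW? (vector x)) * a) ⟨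
    (∑[ x < q ^ n ] (through x + 𝟙 (inW? (vector x)) * a))
      ≡⟨ sum-cong-≗ pointwise ⟩
    (∑[ x < q ^ n ] (𝟙 (inW? (vector x)) * N + a))
      ≡⟨ ∑-distrib-+ (λ x → 𝟙 (inW? (vector x)) * N) (λ _ → a) ⟩
    (∑[ x < q ^ n ] (𝟙 (inW? (vector x)) * N)) + (∑[ x < q ^ n ] a)
      ≡⟨ ≡.cong₂ _+_ (≡.sym (*-distribʳ-sum N (λ x → 𝟙 (inW? (vector x))))) (∑-const (q ^ n) a) ⟩
    count (inW? ∘ vector) * N + q ^ n * a
      ≡⟨ ≡.cong (λ z → z * N + q ^ n * a) (count-vectors W dim-W) ⟩
    q ^ d * N + q ^ n * a ∎
    where
    open ≡.≡-Reasoning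
    open import Data.Nat.Base using (_+_; _*_; _^_)
    ∈-⊆ : ∀ B {x} → x ∈ ⟦ W ⟧ → (⟦ W ⟧ ⊆ ⟦ B ⟧ × x ∈ ⟦ B ⟧) ⇔ (⟦ W ⟧ ⊆ ⟦ B ⟧)
    ∈-⊆ B {x} x∈W = mk⇔ {A = ⟦ W ⟧ ⊆ ⟦ B ⟧ × x ∈ ⟦ B ⟧} {B = ⟦ W ⟧ ⊆ ⟦ B ⟧} proj₁ (λ W⊆ → W⊆ , W⊆ x∈W)
    adjoin-⊆ : ∀ B x → (⟦ W ⟧ ⊆ ⟦ B ⟧ × x ∈ ⟦ B ⟧) ⇔ (⟦ adjoin W x ⟧ ⊆ ⟦ B ⟧)
    adjoin-⊆ B x = mk⇔ {A = ⟦ W ⟧ ⊆ ⟦ B ⟧ × x ∈ ⟦ B ⟧} {B = ⟦ adjoin W x ⟧ ⊆ ⟦ B ⟧} (λ (W⊆ , x∈) → adjoin⊆ W B W⊆ x∈)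
                       (λ W+x⊆ → W+x⊆ ∘ ⊆adjoin W x , W+x⊆ (∈adjoin W x))
    N = containing dim-W
    inW? : ∀ x → Dec (x ∈ ⟦ W ⟧)
    inW? = member? W dim-W
    W⊆? : ∀ i → Dec (⟦ W ⟧ ⊆ ⟦ block i ⟧)
    W⊆? i = contains? (block i) (block-dim i) dim-W
    inBlock? : ∀ i x → Dec (x ∈ ⟦ block i ⟧)
    inBlock? i = member? (block i) (block-dim i)
    through : Fin (q ^ n) → ℕ
    through x = ∑[ i < size ] (𝟙 (W⊆? i) * 𝟙 (inBlock? i (vector x)))
    -- Summed block by block: each of the `N` blocks through `W` contributes its q^k vectors.
    by-block : N * q ^ k ≡ ∑[ x < q ^ n ] through x
    by-block = begin
      N * q ^ k
        ≡⟨ *-distribʳ-sum (q ^ k) (𝟙 ∘ W⊆?) ⟩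
      (∑[ i < size ] (𝟙 (W⊆? i) * q ^ k))
        ≡⟨ sum-cong-≗ (λ i → ≡.trans (≡.cong (𝟙 (W⊆? i) *_) (≡.sym (count-vectors (block i) (block-dim i))))
                                     (*-distribˡ-sum (𝟙 (W⊆? i)) (λ x → 𝟙 (inBlock? i (vector x))))) ⟩
      (∑[ i < size ] ∑[ x < q ^ n ] (𝟙 (W⊆? i) * 𝟙 (inBlock? i (vector x))))
        ≡⟨ ∑-comm (λ i x → 𝟙 (W⊆? i) * 𝟙 (inBlock? i (vector x))) ⟩
      (∑[ x < q ^ n ] through x) ∎
    -- A vector of `W` lies in all `N` blocks through `W`. For any other vector, the blocks
    -- containing it and `W` are those through `adjoin W x`, which number `a`. The extra summand on
    -- each side replaces a factor 1 - 𝟙.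
    pointwise : ∀ x → through x + 𝟙 (inW? (vector x)) * a ≡ 𝟙 (inW? (vector x)) * N + a
    pointwise x = by-cases (inW? (vector x))
      where
      by-cases : (x∈W? : Dec (vector x ∈ ⟦ W ⟧)) → through x + 𝟙 x∈W? * a ≡ 𝟙 x∈W? * N + a
      by-cases (yes x∈W) = ≡.cong₂ _+_
        (≡.trans (sum-cong-≗ λ i → 𝟙-× (W⊆? i) (inBlock? i (vector x)) (W⊆? i) (∈-⊆ (block i) x∈W))
                 (≡.sym (ℕ.+-identityʳ N)))
        (ℕ.+-identityʳ a)
      by-cases (no x∉W) = ≡.trans (ℕ.+-identityʳ (through x)) (≡.trans
        (sum-cong-≗ λ i → 𝟙-× (W⊆? i) (inBlock? i (vector x)) (contains? (block i) (block-dim i) _)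
                              (adjoin-⊆ (block i) (vector x)))
        (regular (vector x) x∉W))

-- Extending the space by one dimension

module Design {q c ℓ} {F : GF q c ℓ} {V : VectorSpace F} {P} (D : SubspaceDesign F V P) where
  open SubspaceDesign D public
  open Blocks dim-V block block-dim public
  open LinearAlgebra.FiniteDimensional F V dim-V

  containing≡λ : ∀ (T : Subspace F V) (dim-T : HasDimension F V ⟦ T ⟧ (Parameters.t P)) →
                 ℤ.+ containing dim-T ℚ./ 1 ≡ Parameters.lambda P
  containing≡λ T dim-T = let (S , S⇔ , ∣S∣≡λ) = balanced T dim-T in
    ≡.trans (≡.cong (λ m → ℤ.+ m ℚ./ 1) (≡.sym (∣∣≡count S (λ i → contains? (block i) (block-dim i) dim-T) S⇔))) ∣S∣≡λ

module _ {q} {{pp : PrimePower q}} {c ℓ} {F : GF q c ℓ} {V : VectorSpace F} where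

  -- If all basis vectors of the space lay in `W`, its dimension would be at most `d`; a finite
  -- search therefore names one outside.
  proper⇒∃∉ : ∀ {n d} (dim-V : HasDimension F V U n) (W : Subspace F V) → HasDimension F V ⟦ W ⟧ d →
              d ℕ.< n → ∃[ x ] ¬ x ∈ ⟦ W ⟧
  proper⇒∃∉ dim-V W dim-W d<n =
    let (i , ∉) = Fin.¬∀⟶∃¬ _ _ (λ i → FiniteDimensional.member? dim-V W dim-W (proj₁ dim-V i))
                    (λ e∈W → ℕ.<⇒≱ d<n (dimension-mono W dim-V dim-W (spanned⊆ W (proj₂ dim-V) e∈W)))
    in proj₁ dim-V i , ∉
    where open LinearAlgebra F V using (dimension-mono; spanned⊆; module FiniteDimensional)

  -- A t-design is a (t-1)-design.
  containing-codimension-1 : ∀ {s n k λ′} (D : SubspaceDesign F V (s -⟨ n , k , λ′ ⟩)) → s ℕ.≤ k → k ℕ.≤ n →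
    ∀ {d} → suc d ≡ s → (W : Subspace F V) (dim-W : HasDimension F V ⟦ W ⟧ d) →
    let instance _ = q^[1+n]∸1≢0 q (k ℕ.∸ s) in
    ℤ.+ Design.containing D dim-W ℚ./ 1 ≡
    λ′ ℚ.* (ℤ.+ (q ℕ.^ suc (n ℕ.∸ s) ℕ.∸ 1) ℚ./ (q ℕ.^ suc (k ℕ.∸ s) ℕ.∸ 1))
  containing-codimension-1 {n = n} {k} D s≤k k≤n {d} ≡.refl W dim-W = let
      -- One superspace of dimension `s` is enough to exhibit λ′ as a natural number `a`; every
      -- other one then has the same count.
      (x₀ , x₀∉W) = proper⇒∃∉ dim-V W dim-W (ℕ.≤-trans s≤k k≤n)
      a           = containing (extended x₀ x₀∉W)
      a≡λ         = containing≡λ (adjoin W x₀) (extended x₀ x₀∉W)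
      counted     = double-count W dim-W {a} λ x x∉W →
                    /1-injective _ _ (≡.trans (containing≡λ (adjoin W x) (extended x x∉W)) (≡.sym a≡λ))
    in ≡.trans
      (Equivalence.from (/1-*⇔ (containing dim-W) a _ (q ℕ.^ suc (k ℕ.∸ suc d) ℕ.∸ 1))
        (cancel-^ {N = containing dim-W} d (suc (k ℕ.∸ suc d)) (suc (n ℕ.∸ suc d))
          (≡.subst₂ (λ k′ n′ → containing dim-W ℕ.* q ℕ.^ k′ ℕ.+ q ℕ.^ d ℕ.* a ≡
                               q ℕ.^ d ℕ.* containing dim-W ℕ.+ q ℕ.^ n′ ℕ.* a)
            (exponent s≤k) (exponent (ℕ.≤-trans s≤k k≤n)) counted)))
      (≡.cong (ℚ._* _) a≡λ)
    where
    open Design D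
    open LinearAlgebra F V
    instance
      _ = q^[1+n]∸1≢0 q (k ℕ.∸ suc d)
      _ = ℕ.nonTrivial⇒nonZero q {{primePower⇒nonTrivial pp}}
    extended : ∀ x → ¬ x ∈ ⟦ W ⟧ → HasDimension F V ⟦ adjoin W x ⟧ (suc d)
    extended x x∉W = x ∷ proj₁ dim-W , adjoin-isBasis W x∉W (proj₂ dim-W)
    -- Since `s` is `suc d`, the exponent m - s + 1 of the statement is m - d, what remains of `m`
    -- after division by q^d.
    exponent : ∀ {m} → suc d ℕ.≤ m → m ≡ suc (m ℕ.∸ suc d) ℕ.+ d
    exponent {m} d<m = ≡.trans (≡.sym (ℕ.m∸n+n≡m d<m)) (ℕ.+-suc (m ℕ.∸ suc d) d)

module Extension {q c ℓ} (F : GF q c ℓ) (V : VectorSpace F) where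
  private
    module F = GF F
    module V = Module V
  open F using (_≈_; 0#; 1#; -_)
  open FiniteField F

  F×V : VectorSpace F
  F×V = DirectProduct.⟨module⟩ TensorUnit.⟨module⟩ V

  private
    module F×V = Module F×V
    module L   = LinearAlgebra F V
    module L′  = LinearAlgebra F F×V

  embedding : V.Carrierᴹ → F×V.Carrierᴹ
  embedding y = 0# , y

  embedding-linear : Linear {F = F} V F×V embedding
  embedding-linear = record
    { cong    = λ y≈z → F.refl , y≈z
    ; +-homo  = λ _ _ → F.sym (F.+-identityˡ 0#) , V.≈ᴹ-refl
    ; *ₗ-homo = λ a _ → F.sym (F.zeroʳ a) , V.≈ᴹ-refl
    }

  proj₂-linear : Linear {F = F} F×V V proj₂
  proj₂-linear = record
    { cong    = proj₂
    ; +-homo  = λ _ _ → V.≈ᴹ-refl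
    ; *ₗ-homo = λ _ _ → V.≈ᴹ-refl
    }

  slice : Subspace F F×V → Subspace F V
  slice = Linear.preimage {F = F} embedding-linear

  embed : Subspace F V → Subspace F F×V
  embed W = record
    { ⟦_⟧       = λ (x , y) → x ≈ 0# × y ∈ ⟦ W ⟧
    ; resp      = λ (x≈ , y≈) (x≈0 , y∈W) → F.trans (F.sym x≈) x≈0 , W.resp y≈ y∈W
    ; 0ᴹ∈       = F.refl , W.0ᴹ∈
    ; +ᴹ-closed = λ (x≈0 , y∈W) (x′≈0 , y′∈W) →
                  F.trans (F.+-cong x≈0 x′≈0) (F.+-identityˡ 0#) , W.+ᴹ-closed y∈W y′∈W
    ; *ₗ-closed = λ a (x≈0 , y∈W) → F.trans (F.*-congˡ x≈0) (F.zeroʳ a) , W.*ₗ-closed a y∈W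
    }
    where module W = Subspace W

  embed-dimension : ∀ W {d} → HasDimension F V ⟦ W ⟧ d → HasDimension F F×V ⟦ embed W ⟧ d
  embed-dimension W (b , b-isBasis) = embedding ∘ b ,
    Linear.image-isBasis {F = F} embedding-linear W {W′ = ⟦ embed W ⟧}
      (λ y∈W → F.refl , y∈W) (λ _ → proj₂) (λ {(x , y)} (x≈0 , y∈W) → y , y∈W , x≈0 , V.≈ᴹ-refl) b-isBasis

  -- Up to equality of vectors, these are all the subspaces that meet H in `W` without lying in H;
  -- `h` matters only modulo `W`.
  cone : Subspace F V → V.Carrierᴹ → Subspace F F×V
  cone W h = L′.adjoin (embed W) (1# , h)

  cone-dimension : ∀ W h {d} → HasDimension F V ⟦ W ⟧ d → HasDimension F F×V ⟦ cone W h ⟧ (suc d)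
  cone-dimension W h dim-W = let (b , b-isBasis) = embed-dimension W dim-W in
    (1# , h) ∷ b , L′.adjoin-isBasis (embed W) (λ (1≈0 , _) → F.0≉1 (F.sym 1≈0)) b-isBasis

  -- Vectors of `embed W` have first coordinate 0, so the coefficient of `(1# , h)` must be the
  -- first coordinate `x`.
  ∈cone⇒ : ∀ {W h x y} → (x , y) ∈ ⟦ cone W h ⟧ → ∃[ w ] w ∈ ⟦ W ⟧ × y V.≈ᴹ w V.+ᴹ x V.*ₗ h
  ∈cone⇒ ((z , w) , a , (z≈0 , w∈W) , x≈ , y≈) = w , w∈W , V.≈ᴹ-trans y≈ (V.+ᴹ-congˡ (V.*ₗ-congʳ
    (F.sym (F.trans x≈ (F.trans (F.+-cong z≈0 (F.*-identityʳ a)) (F.+-identityˡ a))))))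

  ⇒∈cone : ∀ {W h x y w} → w ∈ ⟦ W ⟧ → y V.≈ᴹ w V.+ᴹ x V.*ₗ h → (x , y) ∈ ⟦ cone W h ⟧
  ⇒∈cone {x = x} {w = w} w∈W y≈ =
    (0# , w) , x , (F.refl , w∈W) , F.sym (F.trans (F.+-identityˡ _) (F.*-identityʳ x)) , y≈

  0∈cone⇒ : ∀ {W h y} → (0# , y) ∈ ⟦ cone W h ⟧ → y ∈ ⟦ W ⟧
  0∈cone⇒ {W} {h} y∈ = let (w , w∈W , y≈) = ∈cone⇒ {W} y∈ in Subspace.resp W
    (V.≈ᴹ-sym (V.≈ᴹ-trans y≈ (V.≈ᴹ-trans (V.+ᴹ-congˡ (V.*ₗ-zeroˡ h)) (V.+ᴹ-identityʳ w)))) w∈W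

  1∈cone⇒ : ∀ {W h y} → (1# , y) ∈ ⟦ cone W h ⟧ → ∃[ w ] w ∈ ⟦ W ⟧ × y V.≈ᴹ w V.+ᴹ h
  1∈cone⇒ {W} {h} y∈ = let (w , w∈W , y≈) = ∈cone⇒ {W} y∈ in
    w , w∈W , V.≈ᴹ-trans y≈ (V.+ᴹ-congˡ (V.*ₗ-identityˡ h))

  ⇒1∈cone : ∀ {W h y w} → w ∈ ⟦ W ⟧ → y V.≈ᴹ w V.+ᴹ h → (1# , y) ∈ ⟦ cone W h ⟧
  ⇒1∈cone {W} {h} w∈W y≈ = ⇒∈cone {W} w∈W (V.≈ᴹ-trans y≈ (V.+ᴹ-congˡ (V.≈ᴹ-sym (V.*ₗ-identityˡ h))))

  -- The whole space is the cone over V with apex 0.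
  F×V-dimension : ∀ {n} → HasDimension F V U n → HasDimension F F×V U (suc n)
  F×V-dimension (b , b-isBasis) =
    let (b′ , b′-isBasis) = cone-dimension L.fullSubspace V.0ᴹ
          (b , L.isBasis-resp-≐ {X = U} {X′ = ⟦ L.fullSubspace ⟧} (_ , _) b-isBasis)
    in b′ , L′.isBasis-resp-≐ {X = ⟦ cone L.fullSubspace V.0ᴹ ⟧} {X′ = U} (_ , λ {(x , y)} _ →
       ⇒∈cone {L.fullSubspace} tt (V.≈ᴹ-sym (V.≈ᴹ-trans (V.+ᴹ-congˡ (V.*ₗ-zeroʳ x)) (V.+ᴹ-identityʳ y)))) b′-isBasis

  module Flat (T : Subspace F F×V) (T-flat : ∀ {x y} → (x , y) ∈ ⟦ T ⟧ → x ≈ 0#) where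

    slice-dimension : ∀ {d} → HasDimension F F×V ⟦ T ⟧ d → HasDimension F V ⟦ slice T ⟧ d
    slice-dimension (b , b-isBasis) = proj₂ ∘ b , Linear.image-isBasis {F = F} proj₂-linear T
      (λ {(x , y)} xy∈T → Subspace.resp T (T-flat xy∈T , V.≈ᴹ-refl) xy∈T)
      (λ xy∈T y≈0 → T-flat xy∈T , y≈0)
      (λ {y} y∈ → (0# , y) , y∈ , V.≈ᴹ-refl)
      b-isBasis

    ⊆cone⇔ : ∀ W h → (⟦ T ⟧ ⊆ ⟦ cone W h ⟧) ⇔ (⟦ slice T ⟧ ⊆ ⟦ W ⟧)
    ⊆cone⇔ W h = mk⇔ {A = ⟦ T ⟧ ⊆ ⟦ cone W h ⟧} {B = ⟦ slice T ⟧ ⊆ ⟦ W ⟧}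
      (λ T⊆ y∈ → 0∈cone⇒ {W} (T⊆ y∈))
      (λ slice⊆ xy∈T → L′.⊆adjoin (embed W) _ (flat slice⊆ xy∈T))
      where
      flat : ⟦ slice T ⟧ ⊆ ⟦ W ⟧ → ⟦ T ⟧ ⊆ ⟦ embed W ⟧
      flat slice⊆ xy∈T = T-flat xy∈T , slice⊆ (Subspace.resp T (T-flat xy∈T , V.≈ᴹ-refl) xy∈T)

    ⊆embed⇔ : ∀ W → (⟦ T ⟧ ⊆ ⟦ embed W ⟧) ⇔ (⟦ slice T ⟧ ⊆ ⟦ W ⟧)
    ⊆embed⇔ W = mk⇔ {A = ⟦ T ⟧ ⊆ ⟦ embed W ⟧} {B = ⟦ slice T ⟧ ⊆ ⟦ W ⟧}
      (λ T⊆ y∈ → proj₂ (T⊆ y∈))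
      (λ slice⊆ xy∈T → T-flat xy∈T , slice⊆ (Subspace.resp T (T-flat xy∈T , V.≈ᴹ-refl) xy∈T))

  module Steep (T : Subspace F F×V) {h} (1h∈T : (1# , h) ∈ ⟦ T ⟧) where

    -- Subtracting x times `(1# , h)` from a vector `(x , y)` of `T` leaves a vector of `T` with
    -- first coordinate 0, hence one of the slice.
    ≐cone : ⟦ T ⟧ ≐ ⟦ cone (slice T) h ⟧
    ≐cone = below , λ {z} → L′.adjoin⊆ (embed (slice T)) T embed-slice⊆ 1h∈T {z}
      where
      embed-slice⊆ : ⟦ embed (slice T) ⟧ ⊆ ⟦ T ⟧
      embed-slice⊆ (x≈0 , y∈) = Subspace.resp T (F.sym x≈0 , V.≈ᴹ-refl) y∈
      below : ⟦ T ⟧ ⊆ ⟦ cone (slice T) h ⟧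
      below {x , y} xy∈T = ⇒∈cone {slice T} {w = (- x) V.*ₗ h V.+ᴹ y}
        (Subspace.resp T (F.trans (F.+-congʳ (F.*-identityʳ (- x))) (F.-‿inverseˡ x) , V.≈ᴹ-refl)
          (Subspace.+ᴹ-closed T (Subspace.*ₗ-closed T (- x) 1h∈T) xy∈T))
        (V.≈ᴹ-sym (V.≈ᴹ-trans (V.+ᴹ-comm _ _) (V.≈ᴹ-trans (V.≈ᴹ-sym (V.+ᴹ-assoc _ _ _))
          (V.≈ᴹ-trans (V.+ᴹ-congʳ (V.≈ᴹ-trans (V.≈ᴹ-sym (V.*ₗ-distribʳ h x (- x)))
            (V.≈ᴹ-trans (V.*ₗ-congʳ (F.-‿inverseʳ x)) (V.*ₗ-zeroˡ h)))) (V.+ᴹ-identityˡ y)))))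

    ⊆cone⇒ : ∀ {W h′} → ⟦ T ⟧ ⊆ ⟦ cone W h′ ⟧ → ⟦ slice T ⟧ ⊆ ⟦ W ⟧ × ∃[ w ] w ∈ ⟦ W ⟧ × h V.≈ᴹ w V.+ᴹ h′
    ⊆cone⇒ {W} T⊆ = (λ y∈ → 0∈cone⇒ {W} (T⊆ y∈)) , 1∈cone⇒ {W} (T⊆ 1h∈T)

    ⇒⊆cone : ∀ {W h′ w} → ⟦ slice T ⟧ ⊆ ⟦ W ⟧ → w ∈ ⟦ W ⟧ → h V.≈ᴹ w V.+ᴹ h′ → ⟦ T ⟧ ⊆ ⟦ cone W h′ ⟧
    ⇒⊆cone {W} {h′} slice⊆ w∈W h≈ xy∈T = L′.adjoin⊆ (embed (slice T)) (cone W h′)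
      (λ (x≈0 , y∈) → L′.⊆adjoin (embed W) (1# , h′) (x≈0 , slice⊆ y∈))
      (⇒1∈cone {W} w∈W h≈) (proj₁ ≐cone xy∈T)

  steep : (T : Subspace F F×V) → ∀ {x y} → (x , y) ∈ ⟦ T ⟧ → ¬ x ≈ 0# → ∃[ h ] (1# , h) ∈ ⟦ T ⟧
  steep T {x} {y} xy∈T x≉0 = let (x⁻¹ , xx⁻¹≈1) = F.invertible x x≉0 in
    x⁻¹ V.*ₗ y , Subspace.resp T (F.trans (F.*-comm x⁻¹ x) xx⁻¹≈1 , V.≈ᴹ-refl) (Subspace.*ₗ-closed T x⁻¹ xy∈T)

  -- H is a subspace, so `T` lies in it as soon as a basis does; otherwise some basis vector has an
  -- invertible first coordinate and can be scaled to `(1# , h)`.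
  flat? : (T : Subspace F F×V) → ∀ {d} → HasDimension F F×V ⟦ T ⟧ d →
          (∀ {x y} → (x , y) ∈ ⟦ T ⟧ → x ≈ 0#) ⊎ ∃[ h ] (1# , h) ∈ ⟦ T ⟧
  flat? T (b , b-isBasis) with Fin.all? (λ i → proj₁ (b i) ≈? 0#)
  ... | yes b-flat = inj₁ λ xy∈T →
    proj₁ (L′.spanned⊆ (embed L.fullSubspace) b-isBasis (λ i → b-flat i , tt) xy∈T)
  ... | no ¬b-flat =
    let (i , x≉0) = Fin.¬∀⟶∃¬ _ _ (λ i → proj₁ (b i) ≈? 0#) ¬b-flat
    in inj₂ (steep T (IsBasis.contained b-isBasis i) x≉0)

-- The reduced design

module Construction {q c ℓ} {{pp : PrimePower q}} {F : GF q c ℓ} {V : VectorSpace F} {s n k : ℕ} {λ′ μ : ℚ}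
                    (s≤k : s ≤ k) (k≤n : k ≤ n)
                    (D-design : SubspaceDesign F V (s -⟨ n , k , λ′ ⟩))
                    (R-design : SubspaceDesign F V (s -⟨ n , suc k , μ ⟩)) where
  private
    module F = GF F
    module V = Module V
    module D = Design D-design
    module R = Design R-design
    module L = LinearAlgebra F V
    module FV = L.FiniteDimensional D.dim-V
    -- Here `n` and `k` are one less than the dimensions of the new space and of its blocks, so the
    -- difference is the v - k of the theorem.
    r = n ℕ.∸ k
  open Extension F V
  private
    module L′ = LinearAlgebra F F×V
    dim-F×V : HasDimension F F×V U (suc n)
    dim-F×V = F×V-dimension D.dim-V
    module FF×V = L′.FiniteDimensional dim-F×V

  opaque
    -- The complement comes with an unspecified size; uniqueness of dimension shows that this size
    -- plus `k` is `n`, which fixes it as `r`.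
    complement-basis : ∀ i → Σ[ h ∈ Vector V.Carrierᴹ r ] L.IsBasisMod (D.block i) ⟦ L.fullSubspace ⟧ h
    complement-basis i =
      let (_ , mod-basis , dim-full) =
            FV.complement (D.block i) L.fullSubspace (λ _ → yes tt) (D.block-dim i) _
      in ≡.subst (λ r → Σ[ h ∈ Vector V.Carrierᴹ r ] L.IsBasisMod (D.block i) ⟦ L.fullSubspace ⟧ h)
           (≡.trans (≡.sym (ℕ.m+n∸n≡m _ k)) (≡.cong (ℕ._∸ k) (L.dimension-unique L.fullSubspace dim-full
             (proj₁ D.dim-V , L.isBasis-resp-≐ {X = U} {X′ = ⟦ L.fullSubspace ⟧} (_ , _) (proj₂ D.dim-V)))))
           mod-basis

  Index : Set
  Index = (Fin D.size × Fin (q ℕ.^ r)) ⊎ Fin R.size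

  size : ℕ
  size = D.size ℕ.* q ℕ.^ r ℕ.+ R.size

  index : Fin size → Index
  index = Sum.map₁ (Fin.remQuot (q ℕ.^ r)) ∘ Fin.splitAt (D.size ℕ.* q ℕ.^ r)

  index-injective : Injective _≡_ _≡_ index
  index-injective {x} {y} e = ≡.trans (≡.sym (unindex-index x)) (≡.trans (≡.cong unindex e) (unindex-index y))
    where
    unindex : Index → Fin size
    unindex = Fin.join _ R.size ∘ Sum.map₁ (λ (i , j) → Fin.combine i j)
    unindex-index : ∀ x → unindex (index x) ≡ x
    unindex-index x with Fin.splitAt (D.size ℕ.* q ℕ.^ r) x in eq
    ... | inj₁ ij = ≡.trans (≡.cong (Fin._↑ˡ R.size) (Fin.combine-remQuot {D.size} (q ℕ.^ r) ij))
                            (Fin.splitAt⁻¹-↑ˡ eq)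
    ... | inj₂ l  = Fin.splitAt⁻¹-↑ʳ eq

  ∑-index : (f : Index → ℕ) → ∑[ x < size ] f (index x) ≡
            ∑[ i < D.size ] ∑[ j < q ℕ.^ r ] f (inj₁ (i , j)) ℕ.+ ∑[ l < R.size ] f (inj₂ l)
  ∑-index f = ≡.trans (∑-splitAt (D.size ℕ.* q ℕ.^ r) (f ∘ Sum.map₁ (Fin.remQuot (q ℕ.^ r))))
    (≡.cong (ℕ._+ (∑[ l < R.size ] f (inj₂ l))) (∑-remQuot D.size (f ∘ inj₁)))

  -- Representatives of the cosets of `D.block i` in V, one for each combination of the
  -- complementary basis. A cone depends only on the coset of its apex, so every extension of the
  -- block occurs once.
  apex : ∀ i → Fin (q ℕ.^ r) → V.Carrierᴹ
  apex i = L.vec (proj₁ (complement-basis i))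

  apex-injective : ∀ i {w j j′} → w ∈ ⟦ D.block i ⟧ → apex i j V.≈ᴹ w V.+ᴹ apex i j′ → j ≡ j′
  apex-injective i = L.Mod.vec-injective (proj₂ (complement-basis i))

  apex-surjective : ∀ i h → ∃[ w ] ∃[ j ] w ∈ ⟦ D.block i ⟧ × h V.≈ᴹ w V.+ᴹ apex i j
  apex-surjective i h = L.Mod.vec-surjective (proj₂ (complement-basis i)) tt

  block : Index → Subspace F F×V
  block (inj₁ (i , j)) = cone (D.block i) (apex i j)
  block (inj₂ l)       = embed (R.block l)

  block-dim : ∀ x → HasDimension F F×V ⟦ block x ⟧ (suc k)
  block-dim (inj₁ (i , j)) = cone-dimension (D.block i) (apex i j) (D.block-dim i)
  block-dim (inj₂ l)       = embed-dimension (R.block l) (R.block-dim l)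

  apex∈ : ∀ i j → (F.1# , apex i j) ∈ ⟦ block (inj₁ (i , j)) ⟧
  apex∈ i j = L′.∈adjoin (embed (D.block i)) (F.1# , apex i j)

  base⊆ : ∀ {i j i′ j′} → ⟦ block (inj₁ (i , j)) ⟧ ⊆ ⟦ block (inj₁ (i′ , j′)) ⟧ → ⟦ D.block i ⟧ ⊆ ⟦ D.block i′ ⟧
  base⊆ {i} {i′ = i′} B⊆ y∈ = 0∈cone⇒ {D.block i′} (B⊆ (L′.⊆adjoin (embed (D.block i)) _ (F.refl , y∈)))

  -- Intersecting a cone with H recovers its base and so `i`; its point `(1# , apex i j)` then
  -- determines the coset and so `j`. The same point keeps a cone from equalling a block inside H.
  block-distinct : Injective _≡_ (λ B C → ⟦ B ⟧ ≐ ⟦ C ⟧) block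
  block-distinct {inj₁ (i , j)} {inj₁ (i′ , j′)} (B⊆ , ⊇B)
    with D.block-distinct {i} {i′} (base⊆ {i} {j} {i′} {j′} B⊆ , base⊆ {i′} {j′} {i} {j} ⊇B)
  ... | ≡.refl = let (w , w∈ , h≈) = 1∈cone⇒ {D.block i} (B⊆ (apex∈ i j)) in
                 ≡.cong (λ j → inj₁ (i , j)) (apex-injective i w∈ h≈)
  block-distinct {inj₁ (i , j)} {inj₂ l} (B⊆ , _) = contradiction (F.sym (proj₁ (B⊆ (apex∈ i j)))) F.0≉1
  block-distinct {inj₂ l} {inj₁ (i , j)} (_ , ⊇B) = contradiction (F.sym (proj₁ (⊇B (apex∈ i j)))) F.0≉1
  block-distinct {inj₂ l} {inj₂ l′} (B⊆ , ⊇B) =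
    ≡.cong inj₂ (R.block-distinct ((λ y∈ → proj₂ (B⊆ (F.refl , y∈))) , (λ y∈ → proj₂ (⊇B (F.refl , y∈)))))

  module _ (T : Subspace F F×V) {d} (dim-T : HasDimension F F×V ⟦ T ⟧ d) where

    T⊆? : ∀ x → Dec (⟦ T ⟧ ⊆ ⟦ block x ⟧)
    T⊆? x = FF×V.contains? (block x) (block-dim x) dim-T

    -- For `T` inside H, containment in a cone does not depend on the apex, so every block of D
    -- through the slice counts q^r times.
    count-flat : (T-flat : ∀ {x y} → (x , y) ∈ ⟦ T ⟧ → x F.≈ F.0#) →
      let dim-slice = Flat.slice-dimension T T-flat dim-T in
      count (T⊆? ∘ index) ≡ D.containing dim-slice ℕ.* q ℕ.^ r ℕ.+ R.containing dim-slice
    count-flat T-flat = ≡.trans (∑-index (𝟙 ∘ T⊆?)) (≡.cong₂ ℕ._+_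
      (≡.trans (sum-cong-≗ λ i → ≡.trans (≡.trans
          (sum-cong-≗ λ j → 𝟙-cong (T⊆? (inj₁ (i , j))) (slice⊆D? i) (⊆cone⇔ (D.block i) (apex i j)))
          (∑-const (q ℕ.^ r) (𝟙 (slice⊆D? i))))
          (ℕ.*-comm (q ℕ.^ r) (𝟙 (slice⊆D? i))))
        (≡.sym (*-distribʳ-sum (q ℕ.^ r) (𝟙 ∘ slice⊆D?))))
      (count-cong (T⊆? ∘ inj₂) slice⊆R? (λ l → ⊆embed⇔ (R.block l))))
      where
      open Flat T T-flat
      slice⊆D? : ∀ i → Dec (⟦ slice T ⟧ ⊆ ⟦ D.block i ⟧)
      slice⊆D? i = FV.contains? (D.block i) (D.block-dim i) (slice-dimension dim-T)
      slice⊆R? : ∀ l → Dec (⟦ slice T ⟧ ⊆ ⟦ R.block l ⟧)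
      slice⊆R? l = L.FiniteDimensional.contains? R.dim-V (R.block l) (R.block-dim l) (slice-dimension dim-T)

    -- A cone over `D.block i` contains `T` precisely when the base contains the slice and the apex
    -- represents the coset of `h`, which one `j` does. Blocks inside H miss `(1# , h)`.
    count-steep : ∀ {h} → (F.1# , h) ∈ ⟦ T ⟧ → ∀ {e} (dim-slice : HasDimension F V ⟦ slice T ⟧ e) →
                  count (T⊆? ∘ index) ≡ D.containing dim-slice
    count-steep {h} 1h∈T dim-slice = ≡.trans (∑-index (𝟙 ∘ T⊆?)) (≡.trans (≡.cong₂ ℕ._+_
      (sum-cong-≗ λ i → fibre i (slice⊆D? i))
      (count-none (T⊆? ∘ inj₂) λ l T⊆ → F.0≉1 (F.sym (proj₁ (T⊆ 1h∈T)))))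
      (ℕ.+-identityʳ _))
      where
      open Steep T 1h∈T
      slice⊆D? : ∀ i → Dec (⟦ slice T ⟧ ⊆ ⟦ D.block i ⟧)
      slice⊆D? i = FV.contains? (D.block i) (D.block-dim i) dim-slice
      fibre : ∀ i (slice⊆? : Dec (⟦ slice T ⟧ ⊆ ⟦ D.block i ⟧)) →
              ∑[ j < q ℕ.^ r ] 𝟙 (T⊆? (inj₁ (i , j))) ≡ 𝟙 slice⊆?
      fibre i (yes slice⊆) = let (w , j , w∈ , h≈) = apex-surjective i h in
        count-unique (λ j → T⊆? (inj₁ (i , j))) j (⇒⊆cone {D.block i} slice⊆ w∈ h≈) λ j′ T⊆ →
          let (w′ , w′∈ , h≈′) = proj₂ (⊆cone⇒ {D.block i} T⊆)
          -- From `h = w + apex i j = w′ + apex i j′` the two representatives differ by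
          -- `neg w + w′`, a vector of the block.
          in apex-injective i (Subspace.+ᴹ-closed (D.block i) (Subspace.*ₗ-closed (D.block i) _ w∈) w′∈)
               (V.≈ᴹ-trans (V.≈ᴹ-sym (L.neg-cancelˡ w (apex i j))) (V.≈ᴹ-trans
                 (V.+ᴹ-congˡ (V.≈ᴹ-trans (V.≈ᴹ-sym h≈) h≈′)) (V.≈ᴹ-sym (V.+ᴹ-assoc _ _ _))))
      fibre i (no slice⊈) = count-none (λ j → T⊆? (inj₁ (i , j))) λ j T⊆ →
        slice⊈ λ {y} → proj₁ (⊆cone⇒ {D.block i} T⊆) {y}

  design : ∀ {ν} →
           (∀ (T : Subspace F F×V) (dim-T : HasDimension F F×V ⟦ T ⟧ s) → ℤ.+ count (T⊆? T dim-T ∘ index) ℚ./ 1 ≡ ν) →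
           SubspaceDesign F F×V (s -⟨ suc n , suc k , ν ⟩)
  design counted = record
    { dim-V          = dim-F×V
    ; size           = size
    ; block          = block ∘ index
    ; block-distinct = λ {x} {y} B≐ → index-injective (block-distinct {index x} {index y} B≐)
    ; block-dim      = block-dim ∘ index
    ; balanced       = λ T dim-T →
        select (T⊆? T dim-T ∘ index) , ∈-select (T⊆? T dim-T ∘ index) ,
        ≡.trans (≡.cong (λ m → ℤ.+ m ℚ./ 1)
          (∣∣≡count (select (T⊆? T dim-T ∘ index)) (T⊆? T dim-T ∘ index) (∈-select (T⊆? T dim-T ∘ index))))
          (counted T dim-T)
    }

-- Arithmetic of the block number for subspaces of H

∸1-* : ∀ x y .{{_ : ℕ.NonZero x}} .{{_ : ℕ.NonZero y}} → x ℕ.* (y ℕ.∸ 1) ℕ.+ (x ℕ.∸ 1) ≡ x ℕ.* y ℕ.∸ 1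
∸1-* (suc x) (suc y) = expand x y
  where
  expand : ∀ x y → suc x ℕ.* y ℕ.+ x ≡ y ℕ.+ x ℕ.* suc y
  expand = solve-∀

module _ {q} {{pp : PrimePower q}} where

  private instance
    q-nonZero : ℕ.NonZero q
    q-nonZero = ℕ.nonTrivial⇒nonZero q {{primePower⇒nonTrivial pp}}

  -- The hypothesis is the residual parameter with its denominator cleared. After multiplication by
  -- q^u - 1 the sum telescopes to q^(r+u) - 1, and r + u = (n - k) + (k - s + 1) = n - s + 1.
  reduced-count : ∀ {s k n a M} → s ≤ k → k ≤ n →
    M ℕ.* (q ℕ.^ suc (k ℕ.∸ s) ℕ.∸ 1) ≡ a ℕ.* (q ℕ.^ (n ℕ.∸ k) ℕ.∸ 1) →
    (a ℕ.* q ℕ.^ (n ℕ.∸ k) ℕ.+ M) ℕ.* (q ℕ.^ suc (k ℕ.∸ s) ℕ.∸ 1) ≡ a ℕ.* (q ℕ.^ suc (n ℕ.∸ s) ℕ.∸ 1)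
  reduced-count {s} {k} {n} {a} {M} s≤k k≤n e = begin
    (a * q ^ r + M) * (q ^ u ∸ 1)                     ≡⟨ ℕ.*-distribʳ-+ (q ^ u ∸ 1) (a * q ^ r) M ⟩
    a * q ^ r * (q ^ u ∸ 1) + M * (q ^ u ∸ 1)         ≡⟨ ≡.cong₂ _+_ (ℕ.*-assoc a (q ^ r) _) e ⟩
    a * (q ^ r * (q ^ u ∸ 1)) + a * (q ^ r ∸ 1)       ≡⟨ ℕ.*-distribˡ-+ a _ _ ⟨
    a * (q ^ r * (q ^ u ∸ 1) + (q ^ r ∸ 1))           ≡⟨ ≡.cong (a *_) (∸1-* (q ^ r) (q ^ u)) ⟩
    a * (q ^ r * q ^ u ∸ 1)                           ≡⟨ ≡.cong (λ z → a * (z ∸ 1)) (ℕ.^-distribˡ-+-* q r u) ⟨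
    a * (q ^ (r + u) ∸ 1)                             ≡⟨ ≡.cong (λ z → a * (q ^ z ∸ 1)) exponent ⟩
    a * (q ^ suc (n ∸ s) ∸ 1)                         ∎
    where
    open ≡.≡-Reasoning
    open import Data.Nat.Base using (_+_; _*_; _∸_; _^_)
    r = n ∸ k
    u = suc (k ∸ s)
    instance
      _ = ℕ.m^n≢0 q r
      _ = ℕ.m^n≢0 q u
    exponent : r + u ≡ suc (n ∸ s)
    exponent = ≡.trans (ℕ.+-suc r (k ∸ s)) (≡.cong suc
      (≡.trans (≡.sym (ℕ.+-∸-assoc r s≤k)) (≡.cong (_∸ s) (ℕ.m∸n+n≡m k≤n))))

module _ {q c ℓ} {{pp : PrimePower q}} {F : GF q c ℓ} {V : VectorSpace F} {s n k : ℕ} {λ′ : ℚ}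
         (s≤k : s ≤ k) (k≤n : k ≤ n) where
  private instance
    d-nonZero : ℕ.NonZero (q ℕ.^ suc (k ℕ.∸ s) ℕ.∸ 1)
    d-nonZero = q^[1+n]∸1≢0 q (k ℕ.∸ s) {{pp}}

  derived-residual⇒reduced :
    SubspaceDesign F V (derived (suc s -⟨ suc n , suc k , λ′ ⟩)) →
    SubspaceDesign F V (residual (suc s -⟨ suc n , suc k , λ′ ⟩)) →
    SubspaceDesign F (Extension.F×V F V) (reduced (suc s -⟨ suc n , suc k , λ′ ⟩))
  derived-residual⇒reduced D-design R-design = design λ T dim-T → counted T dim-T (flat? T dim-T)
    where
    open Construction s≤k k≤n D-design R-design
    open Extension F V
    module D = Design D-design
    module R = Design R-design
    c′ = q ℕ.^ suc (n ℕ.∸ s) ℕ.∸ 1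
    d  = q ℕ.^ suc (k ℕ.∸ s) ℕ.∸ 1
    counted : ∀ (T : Subspace F F×V) (dim-T : HasDimension F F×V ⟦ T ⟧ s) →
              (∀ {x y} → (x , y) ∈ ⟦ T ⟧ → GF._≈_ F x (GF.0# F)) ⊎ (∃[ h ] (GF.1# F , h) ∈ ⟦ T ⟧) →
              ℤ.+ count (T⊆? T dim-T ∘ index) ℚ./ 1 ≡ λ′ ℚ.* (ℤ.+ c′ ℚ./ d)
    counted T dim-T (inj₁ T-flat) = ≡.trans (≡.cong (λ m → ℤ.+ m ℚ./ 1) (count-flat T dim-T T-flat)) (≡.trans
        (Equivalence.from (/1-*⇔ (a ℕ.* q ℕ.^ (n ℕ.∸ k) ℕ.+ M) a c′ d) (reduced-count {a = a} {M} s≤k k≤n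
          (Equivalence.to (/1-*⇔ M a (q ℕ.^ (n ℕ.∸ k) ℕ.∸ 1) d)
            (≡.trans (R.containing≡λ (slice T) dim-slice) (≡.cong (ℚ._* _) (≡.sym a≡λ))))))
        (≡.cong (ℚ._* _) a≡λ))
      where
      dim-slice = Flat.slice-dimension T T-flat dim-T
      a = D.containing dim-slice
      M = R.containing dim-slice
      -- The slice is an s-subspace of V, so it realises λ′ as the count `a`; the residual parameter
      -- thereby becomes a condition on the natural numbers `a` and `M`.
      a≡λ = D.containing≡λ (slice T) dim-slice
    counted T dim-T (inj₂ (h , 1h∈T)) =
      -- A basis of the slice is found by greedy extension, with `e` unknown at first. Since `T` is
      -- the cone over its slice, uniqueness of dimension gives `suc e ≡ s`.
      let (e , dim-slice) = LinearAlgebra.FiniteDimensional.dimension F V D.dim-V (slice T)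
                              (λ y → LinearAlgebra.FiniteDimensional.member? F F×V (F×V-dimension D.dim-V) T dim-T (embedding y))
          (b , b-isBasis) = cone-dimension (slice T) h dim-slice
          (T⊆cone , cone⊆T) = Steep.≐cone T 1h∈T
          1+e≡s = LinearAlgebra.dimension-unique F F×V T
                    (b , LinearAlgebra.isBasis-resp-≐ F F×V
                           {X = ⟦ cone (slice T) h ⟧} {X′ = ⟦ T ⟧} (cone⊆T , T⊆cone) b-isBasis) dim-T
      in ≡.trans (≡.cong (λ m → ℤ.+ m ℚ./ 1) (count-steep T dim-T 1h∈T dim-slice))
                 (containing-codimension-1 D-design s≤k k≤n 1+e≡s (slice T) dim-slice)

theorem14 : ∀ {c ℓ : Level} (q : ℕ) {{_ : PrimePower q}} (F : GF q c ℓ)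
    (t v k : ℕ) (lambda : ℚ) →
    1 ≤ t → t ≤ k → k ≤ v → 0ℚ ≤ℚ lambda →
    Realizable F (derived (t -⟨ v , k , lambda ⟩)) →
    Realizable F (residual (t -⟨ v , k , lambda ⟩)) →
    Realizable F (reduced (t -⟨ v , k , lambda ⟩))
-- The bounds `1 ≤ t ≤ k ≤ v` make all three numbers successors, so the predecessors in the
-- parameter sets reduce. The space of the derived design serves as V, and the residual design is
-- moved there.
theorem14 q F (suc s) (suc n) (suc k) lambda _ (ℕ.s≤s s≤k) (ℕ.s≤s k≤n) _ (V , D) (V′ , R) =
  Extension.F×V F V , derived-residual⇒reduced s≤k k≤n D (transfer (SubspaceDesign.dim-V D) R)
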